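{- For every positive integer $d$ there is a constant $C_d$ such that for every $(d+1)$-dimensional simplicial polytope $\mathbf{P}$ on $n$ vertices, $\chi(\mathcal{F}(\mathbf{P}))\leq C_d\, n^{\frac{\lceil d/2\rceil-1}{d}}$ (for $n\ge 1$); i.e. $\chi(\mathcal{F}(\mathbf{P}))\in O(n^{\frac{\lceil d/2\rceil-1}{d}})$.
   Context: For a polytope $\mathbf{P}$, $\mathcal{F}(\mathbf{P})$ is the hypergraph on the vertex set of $\mathbf{P}$ whose hyperedges are the vertex sets of the facets. For a hypergraph $\mathcal{H}$, a (weak) coloring with $m$ colors is a map $c:V(\mathcal{H})\to[m]$ such that no hyperedge is contained in a single color class $c^{ -1}(i)$; $\chi(\mathcal{H})$ is the minimum number of colors of such a coloring. -}

module Defs where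

open import Algebra.Apartness.Bundles using (HeytingField)
open import Algebra.Bundles using (CommutativeRing)
import Algebra.Definitions.RawMonoid as RawMonoidDefinitions
import Algebra.Properties.Semiring.Sum as SemiringSum
open import Data.Fin.Base using (Fin)
open import Data.Fin.Subset using (Subset; _∈_)
open import Data.Nat.Base as ℕ using (ℕ; suc)
open import Data.Product.Base using (Σ; ∃; ∃-syntax; _×_)
open import Data.Sum.Base using (_⊎_)
open import Data.Vec.Functional using (Vector)
import Data.Vec.Functional.Relation.Binary.Equality.Setoid as VectorEquality
open import Function.Bundles using (_⇔_)
open import Function.Definitions using (Injective)
open import Level using (Level; _⊔_) renaming (suc to lsuc)
open import Relation.Binary.Core using (Rel)
open import Relation.Binary.PropositionalEquality.Core using (_≡_)
open import Relation.Binary.Structures using (IsStrictPartialOrder)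
open import Relation.Nullary.Negation.Core using (¬_)
open import Relation.Unary using (Pred; _≐_)

-- The real numbers, given by their characterization as a Cauchy-complete
-- Archimedean ordered field.  The order axioms are the constructive ones
-- (trichotomy is not a field of the record), so that constructive models of
-- the reals qualify; classically these structures are exactly the copies of ℝ.
record Reals (c ℓ₁ ℓ₂ ℓ₃ : Level) : Set (lsuc (c ⊔ ℓ₁ ⊔ ℓ₂ ⊔ ℓ₃)) where
  infix 4 _<_ _≤_
  field
    heytingField : HeytingField c ℓ₁ ℓ₂

  open HeytingField heytingField public

  commutativeRing : CommutativeRing c ℓ₁
  commutativeRing = record { isCommutativeRing = isCommutativeRing }

  open CommutativeRing commutativeRing public
    using (semiring; +-rawMonoid)
  open RawMonoidDefinitions +-rawMonoid public
    using () renaming (_×_ to _·_)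

  field
    _<_                  : Rel Carrier ℓ₃
    isStrictPartialOrder : IsStrictPartialOrder _≈_ _<_
    #⇒<⊎>                : ∀ {x y} → x # y → x < y ⊎ y < x
    <⇒#                  : ∀ {x y} → x < y → x # y
    +-monoˡ-<            : ∀ {x y} z → x < y → x + z < y + z
    *-pos                : ∀ {x y} → 0# < x → 0# < y → 0# < x * y
    archimedean          : ∀ x → ∃[ n ] x < n · 1#

  _≤_ : Rel Carrier ℓ₃
  x ≤ y = ¬ (y < x)

  Cauchy : (ℕ → Carrier) → Set (c ⊔ ℓ₃)
  Cauchy s = ∀ ε → 0# < ε →
    ∃[ N ] ∀ i j → N ℕ.≤ i → N ℕ.≤ j → s i - s j < ε

  _ConvergesTo_ : (ℕ → Carrier) → Carrier → Set (c ⊔ ℓ₃)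
  s ConvergesTo x = ∀ ε → 0# < ε →
    ∃[ N ] ∀ i → N ℕ.≤ i → (s i - x < ε) × (x - s i < ε)

  field
    complete : ∀ s → Cauchy s → ∃[ x ] s ConvergesTo x

record Hypergraph (n : ℕ) (ℓ : Level) : Set (lsuc ℓ) where
  field
    Edge : Pred (Subset n) ℓ

module _ {n : ℕ} {ℓ : Level} (H : Hypergraph n ℓ) where
  open Hypergraph H

  IsWeakColoring : ∀ {m} → (Fin n → Fin m) → Set ℓ
  IsWeakColoring {m} c =
    ∀ e → Edge e → (k : Fin m) → ¬ (∀ i → i ∈ e → c i ≡ k)

  Colorable : ℕ → Set ℓ
  Colorable m = Σ (Fin n → Fin m) IsWeakColoring

  IsChromaticNumber : ℕ → Set ℓ
  IsChromaticNumber k = Colorable k × (∀ m → Colorable m → k ℕ.≤ m)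

module Polytopes {c ℓ₁ ℓ₂ ℓ₃ : Level} (ℝ : Reals c ℓ₁ ℓ₂ ℓ₃) where
  open Reals ℝ
  open SemiringSum semiring using (sum)
  open VectorEquality setoid using (_≋_)

  Point : ℕ → Set c
  Point N = Vector Carrier N

  ⟨_,_⟩ : ∀ {N} → Point N → Point N → Carrier
  ⟨ a , x ⟩ = sum (λ j → a j * x j)

  combination : ∀ {N n} → Vector Carrier n → Vector (Point N) n → Point N
  combination t v j = sum (λ i → t i * v i j)

  conv : ∀ {N n} → Vector (Point N) n → Pred (Point N) (c ⊔ ℓ₁ ⊔ ℓ₃)
  conv {n = n} v x = Σ (Vector Carrier n) λ t →
    (∀ i → 0# ≤ t i) × (sum t ≈ 1#) × (x ≋ combination t v)

  AffinelyIndependent : ∀ {N n} → Vector (Point N) n → Set (c ⊔ ℓ₁)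
  AffinelyIndependent v =
    ∀ t → sum t ≈ 0# → (∀ j → combination t v j ≈ 0#) → ∀ i → t i ≈ 0#

  ContainsIndependent : ∀ {N ℓ} → Pred (Point N) ℓ → ℕ → Set (c ⊔ ℓ₁ ⊔ ℓ)
  ContainsIndependent {N} S m =
    Σ (Vector (Point N) m) λ w → (∀ i → S (w i)) × AffinelyIndependent w

  -- Dimension of the affine hull: an affinely independent family of maximal
  -- size in S has one more member than the dimension.
  HasDimension : ∀ {N ℓ} → Pred (Point N) ℓ → ℕ → Set (c ⊔ ℓ₁ ⊔ ℓ)
  HasDimension S k =
    ContainsIndependent S (suc k) × ¬ ContainsIndependent S (suc (suc k))

  IsSimplex : ∀ {N ℓ} → Pred (Point N) ℓ → Set (c ⊔ ℓ₁ ⊔ ℓ₃ ⊔ ℓ)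
  IsSimplex {N} S =
    ∃[ m ] Σ (Vector (Point N) m) λ w → AffinelyIndependent w × (S ≐ conv w)

  -- The inequality need not be strict anywhere, so K itself is a face
  -- (as may be the empty set).
  IsFace : ∀ {N ℓ ℓ′} → Pred (Point N) ℓ → Pred (Point N) ℓ′ →
           Set (c ⊔ ℓ₁ ⊔ ℓ₃ ⊔ ℓ ⊔ ℓ′)
  IsFace {N} K F = Σ (Point N) λ a → Σ Carrier λ b →
    (∀ x → K x → ⟨ a , x ⟩ ≤ b) × (F ≐ λ x → K x × (⟨ a , x ⟩ ≈ b))

  IsFacet : ∀ {N ℓ ℓ′} → Pred (Point N) ℓ → Pred (Point N) ℓ′ →
            Set (c ⊔ ℓ₁ ⊔ ℓ₃ ⊔ ℓ ⊔ ℓ′)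
  IsFacet K F =
    IsFace K F × (∃[ k ] HasDimension K (suc k) × HasDimension F k)

  -- A polytope in ℝᴺ, presented by an enumeration without repetition of its
  -- vertices (its 0-dimensional faces).  No face {x} can be missing from the
  -- enumeration: a face of the convex hull that is a single point is one of
  -- the points spanning the hull.
  record Polytope (N n : ℕ) : Set (c ⊔ ℓ₁ ⊔ ℓ₃) where
    field
      vertex : Vector (Point N) n

    body : Pred (Point N) (c ⊔ ℓ₁ ⊔ ℓ₃)
    body = conv vertex

    field
      vertex-injective : Injective _≡_ _≋_ vertex
      vertex-isFace    : ∀ i → IsFace body (_≋ vertex i)

  open Polytope public using (body)

  module _ {N n : ℕ} (P : Polytope N n) where
    open Polytope P using (vertex)

    Facet : Pred (Pred (Point N) (c ⊔ ℓ₁ ⊔ ℓ₃)) (c ⊔ ℓ₁ ⊔ ℓ₃)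
    Facet F = IsFacet (body P) F

    Simplicial : Set (lsuc (c ⊔ ℓ₁ ⊔ ℓ₃))
    Simplicial = ∀ F → Facet F → IsSimplex F

    facetHypergraph : Hypergraph n (lsuc (c ⊔ ℓ₁ ⊔ ℓ₃))
    facetHypergraph = record
      { Edge = λ e → ∃[ F ] Facet F × (∀ i → i ∈ e ⇔ F (vertex i)) }

-- Each facet e carries a height functional: affine, nonnegative on the polytope, zero
-- exactly on e, with vertex values adding up to 1.  Expanding any vertex p affinely over
-- the barycentre and the vertices j of e, with coefficients s_j(p), the heights of two
-- facets satisfy h′(p) = h(p) + Σ_j s_j(p) h′(j).  Split e by the lexicographic signs of the
-- vectors s_j.  If the facets have the same negative part, then h′ − h and h − h′ are
-- both lexicographically nonnegative, so the facets coincide; likewise for the positive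
-- parts.  One of the two parts has at most ⌈d/2⌉ vertices, so a set of w vertices contains
-- at most 2(w + 1)^⌈d/2⌉ facets.
--
-- If ⌈d/2⌉ = 1, every vertex set has a vertex of bounded degree, and colouring greedily
-- uses boundedly many colours.  Otherwise colour w vertices at random with about
-- w^((⌈d/2⌉ - 1)/d) colours; few facets are monochromatic, and hitting each of them with
-- one vertex leaves at most w/2^d vertices to be coloured anew with fresh colours.  The
-- numbers of colours of these rounds decrease geometrically.
--
-- The order of the reals is not decidable, but the claim is a decidable inequality, so
-- the geometry can be carried out under a double negation.

module Submission where

open import Defs

open import Algebra.Bundles using (CommutativeRing; Semiring)
import Algebra.Properties.Ring as RingProperties
import Algebra.Properties.Semiring.Sum as SemiringSum
import Algebra.Solver.Ring.NaturalCoefficients.Default as SemiringSolver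
import Data.Bool.Properties as Bool
open import Data.Empty using (⊥-elim)
open import Data.Fin.Base using (Fin; zero; suc)
import Data.Fin.Properties as Fin
open import Data.Fin.Subset using (Subset; Side; inside; outside; _∈_; _∉_; ∣_∣; _∩_; ∁) renaming (_-_ to _∖_)
import Data.Fin.Subset.Properties as Subset
open import Data.Nat.Base as ℕ using (ℕ; zero; suc)
import Data.Nat.Properties as ℕ
open import Data.Product.Base using (Σ; ∃-syntax; _×_; _,_; proj₁; proj₂)
open import Data.Sum.Base using (_⊎_; inj₁; inj₂; [_,_]′)
open import Data.Vec.Base using ([]; _∷_; here; there; tabulate)
open import Data.Vec.Functional using (Vector) renaming (_∷_ to _◂_)
import Data.Vec.Functional.Relation.Binary.Equality.Setoid as VectorEquality
open import Data.Vec.Properties using (lookup∘tabulate; lookup⇒[]=; []=⇒lookup; ≡-dec)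
open import Effect.Monad using (RawMonad)
open import Function.Base using (_∘_; id)
open import Function.Bundles using (_⇔_; Equivalence)
open import Level using (_⊔_)
open import Relation.Binary.Definitions using (tri<; tri≈; tri>)
open import Relation.Binary.PropositionalEquality.Core as ≡ using (_≡_; _≢_)
import Relation.Binary.Reasoning.Setoid as SetoidReasoning
open import Relation.Binary.Structures using (IsStrictPartialOrder)
open import Relation.Nullary using (¬_; Dec; yes; no; ¬?; contradiction)
open import Relation.Nullary.Decidable using (_×-dec_; ¬¬-excluded-middle; decidable-stable)
open import Relation.Nullary.Negation using (¬¬-Monad)
open import Relation.Unary using (Pred)

-- The Kronecker delta over a semiring.

module Kronecker {c ℓ} (R : Semiring c ℓ) where
  private module R = Semiring R
  open R using (Carrier; _≈_; 0#; 1#)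
  open SemiringSum R using (sum; sum-cong-≋; sum-replicate-zero)

  δ : ∀ {n} → Fin n → Fin n → Carrier
  δ zero    zero    = 1#
  δ zero    (suc _) = 0#
  δ (suc _) zero    = 0#
  δ (suc i) (suc j) = δ i j

  δ-refl : ∀ {n} (i : Fin n) → δ i i ≡ 1#
  δ-refl zero    = ≡.refl
  δ-refl (suc i) = δ-refl i

  δ-≢ : ∀ {n} {i j : Fin n} → i ≢ j → δ i j ≡ 0#
  δ-≢ {i = zero}  {zero}  i≢j = contradiction ≡.refl i≢j
  δ-≢ {i = zero}  {suc _} i≢j = ≡.refl
  δ-≢ {i = suc _} {zero}  i≢j = ≡.refl
  δ-≢ {i = suc _} {suc _} i≢j = δ-≢ (i≢j ∘ ≡.cong suc)

  sum-zero : ∀ {n} {f : Vector Carrier n} → (∀ i → f i ≈ 0#) → sum f ≈ 0#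
  sum-zero {n} f≈0 = R.trans (sum-cong-≋ f≈0) (sum-replicate-zero n)

  sum-δ : ∀ {n} (j : Fin n) (f : Vector Carrier n) → sum (λ i → δ j i R.* f i) ≈ f j
  sum-δ zero    f = R.trans (R.+-cong (R.*-identityˡ _) (sum-zero {f = λ i → 0# R.* f (suc i)} (λ i → R.zeroˡ (f (suc i))))) (R.+-identityʳ _)
  sum-δ (suc j) f = R.trans (R.+-cong (R.zeroˡ _) (sum-δ j (f ∘ suc))) (R.+-identityˡ _)

-- Subsets, edge lists and colourings of a finite set.

module Combinatorics where
  open import Data.Fin.Base using (splitAt; _↑ˡ_; _↑ʳ_)
  open import Data.Fin.Subset
  open import Data.Fin.Subset.Properties
  open import Data.List.Base as List using (List; []; _∷_; length)
  import Data.List.Membership.DecPropositional as DecMembership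
  open import Data.List.Membership.Propositional using () renaming (_∈_ to _∈ˡ_; _∉_ to _∉ˡ_)
  import Data.List.Membership.Propositional.Properties as ∈ˡ
  open import Data.List.Properties using (length-map; length-++)
  open import Data.List.Relation.Unary.All as All using (All; []; _∷_)
  import Data.List.Relation.Unary.All.Properties as All
  open import Data.List.Relation.Unary.Any as Any using (here; there)
  import Data.List.Relation.Unary.Any.Properties as Any
  open import Data.Nat.Base
  open import Data.Nat.Properties
  open import Data.Nat.Tactic.RingSolver using (solve-∀)
  open import Data.Vec.Base using (Vec; lookup)
  open import Relation.Binary.PropositionalEquality

  open Kronecker +-*-semiring using (δ; δ-refl; sum-δ)
  open SemiringSum +-*-semiring using (sum; sum-cong-≗; ∑-distrib-+; ∑-comm; *-distribˡ-sum; *-distribʳ-sum)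

  sum-const : ∀ k a → sum {k} (λ _ → a) ≡ k * a
  sum-const zero    a = refl
  sum-const (suc k) a = cong (a +_) (sum-const k a)

  term≤sum : ∀ {n} (f : Vector ℕ n) i → f i ≤ sum f
  term≤sum f zero    = m≤m+n _ _
  term≤sum f (suc i) = ≤-trans (term≤sum (f ∘ suc) i) (m≤n+m _ _)

  belowAverage : ∀ {k} (g : Vector ℕ (suc k)) → ∃[ x ] suc k * g x ≤ sum g
  belowAverage {zero}  g = zero , ≤-refl
  belowAverage {suc k} g with belowAverage (g ∘ suc)
  ... | x , p with ≤-total (g zero) (g (suc x))
  ...   | inj₁ g₀≤ = zero , +-monoʳ-≤ (g zero) (≤-trans (*-monoʳ-≤ (suc k) g₀≤) p)
  ...   | inj₂ ≤g₀ = suc x , +-mono-≤ ≤g₀ p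

  -- The first moment of a uniformly random colouring.

  module _ {k : ℕ} where

    -- Summing over all `k ^ n` colourings gives `k ^ n` times the expectation; working with totals
    -- keeps the probabilistic argument within ℕ.
    total : ∀ n → (Vec (Fin k) n → ℕ) → ℕ
    total zero    f = f []
    total (suc n) f = sum (λ x → total n (λ c → f (x ∷ c)))

    total-+ : ∀ n f g → total n (λ c → f c + g c) ≡ total n f + total n g
    total-+ zero    f g = refl
    total-+ (suc n) f g = trans (sum-cong-≗ (λ x → total-+ n (f ∘ (x ∷_)) (g ∘ (x ∷_)))) (∑-distrib-+ {k} _ _)

    total-zero : ∀ n → total n (λ _ → 0) ≡ 0
    total-zero zero    = refl
    total-zero (suc n) = trans (sum-cong-≗ {k} (λ _ → total-zero n)) (trans (sum-const k 0) (*-zeroʳ k))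

    total-*ˡ : ∀ n a f → total n (λ c → a * f c) ≡ a * total n f
    total-*ˡ zero    a f = refl
    total-*ˡ (suc n) a f =
      trans (sum-cong-≗ {k} (λ x → total-*ˡ n a (f ∘ (x ∷_)))) (sym (*-distribˡ-sum {k} a _))

    total-sum : ∀ n {m} (f : Fin m → Vec (Fin k) n → ℕ) →
                total n (λ c → sum (λ j → f j c)) ≡ sum (λ j → total n (f j))
    total-sum zero    f = refl
    total-sum (suc n) {m} f =
      trans (sum-cong-≗ {k} (λ x → total-sum n (λ j → f j ∘ (x ∷_)))) (∑-comm {k} {m} (λ x j → total n (f j ∘ (x ∷_))))

    -- A product over the elements of `e`, so that its total factors over the coordinates.
    indicator : ∀ {n} → Fin k → Subset n → Vec (Fin k) n → ℕ
    indicator j []            []      = 1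
    indicator j (outside ∷ e) (x ∷ c) = indicator j e c
    indicator j (inside  ∷ e) (x ∷ c) = δ j x * indicator j e c

    indicator-mono : ∀ {n} j (e : Subset n) c → (∀ {i} → i ∈ e → lookup c i ≡ j) → indicator j e c ≡ 1
    indicator-mono j []            []      mono = refl
    indicator-mono j (outside ∷ e) (x ∷ c) mono = indicator-mono j e c (mono ∘ there)
    indicator-mono j (inside  ∷ e) (x ∷ c) mono with refl ← mono here =
      cong₂ _*_ (δ-refl j) (indicator-mono j e c (mono ∘ there))

    -- Each element of `e` pins one coordinate to `j` and all other coordinates are free;
    -- multiplying out avoids the exponent `n - ∣ e ∣`.
    total-indicator : ∀ {n} j (e : Subset n) → total n (indicator j e) * k ^ ∣ e ∣ ≡ k ^ n
    total-indicator         j []            = refl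
    total-indicator {suc n} j (outside ∷ e) = begin
      sum {k} (λ _ → total n (indicator j e)) * k ^ ∣ e ∣
        ≡⟨ cong (_* k ^ ∣ e ∣) (sum-const k _) ⟩
      k * total n (indicator j e) * k ^ ∣ e ∣
        ≡⟨ *-assoc k _ _ ⟩
      k * (total n (indicator j e) * k ^ ∣ e ∣)
        ≡⟨ cong (k *_) (total-indicator j e) ⟩
      k * k ^ n ∎
      where open ≡-Reasoning
    total-indicator {suc n} j (inside ∷ e) = begin
      sum (λ x → total n (λ c → δ j x * indicator j e c)) * (k * k ^ ∣ e ∣)
        ≡⟨ cong (_* (k * k ^ ∣ e ∣)) (sum-cong-≗ {k} (λ x → total-*ˡ n (δ j x) (indicator j e))) ⟩
      sum (λ x → δ j x * total n (indicator j e)) * (k * k ^ ∣ e ∣)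
        ≡⟨ cong (_* (k * k ^ ∣ e ∣)) (sum-δ j (λ _ → total n (indicator j e))) ⟩
      total n (indicator j e) * (k * k ^ ∣ e ∣)
        ≡⟨ shuffle (total n (indicator j e)) k (k ^ ∣ e ∣) ⟩
      k * (total n (indicator j e) * k ^ ∣ e ∣)
        ≡⟨ cong (k *_) (total-indicator j e) ⟩
      k * k ^ n ∎
      where
      open ≡-Reasoning
      shuffle : ∀ a b c → a * (b * c) ≡ b * (a * c)
      shuffle = solve-∀

    -- For a nonempty edge the inner sum is 1 or 0, so on nonempty edges this counts the
    -- monochromatic ones.
    monoCount : ∀ {n} → List (Subset n) → Vec (Fin k) n → ℕ
    monoCount []      c = 0
    monoCount (e ∷ L) c = sum (λ j → indicator j e c) + monoCount L c

    total-monoCount : ∀ {n d} (L : List (Subset n)) → All (λ e → ∣ e ∣ ≡ d) L →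
                      total n (monoCount L) * k ^ d ≡ length L * (k * k ^ n)
    total-monoCount {n} []      []           = cong (_* _) (total-zero n)
    total-monoCount {n} (e ∷ L) (refl ∷ all) = begin
      total n (monoCount (e ∷ L)) * k ^ ∣ e ∣
        ≡⟨ cong (_* k ^ ∣ e ∣) (total-+ n (λ c → sum (λ j → indicator j e c)) (monoCount L)) ⟩
      (total n (λ c → sum (λ j → indicator j e c)) + total n (monoCount L)) * k ^ ∣ e ∣
        ≡⟨ *-distribʳ-+ (k ^ ∣ e ∣) (total n (λ c → sum (λ j → indicator j e c))) (total n (monoCount L)) ⟩
      total n (λ c → sum (λ j → indicator j e c)) * k ^ ∣ e ∣ + total n (monoCount L) * k ^ ∣ e ∣
        ≡⟨ cong₂ _+_ edge (total-monoCount L all) ⟩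
      k * k ^ n + length L * (k * k ^ n) ∎
      where
      open ≡-Reasoning
      edge : total n (λ c → sum (λ j → indicator j e c)) * k ^ ∣ e ∣ ≡ k * k ^ n
      edge = begin
        total n (λ c → sum (λ j → indicator j e c)) * k ^ ∣ e ∣
          ≡⟨ cong (_* k ^ ∣ e ∣) (total-sum n (λ j → indicator j e)) ⟩
        sum (λ j → total n (indicator j e)) * k ^ ∣ e ∣
          ≡⟨ *-distribʳ-sum {k} (k ^ ∣ e ∣) _ ⟩
        sum (λ j → total n (indicator j e) * k ^ ∣ e ∣)
          ≡⟨ sum-cong-≗ {k} (λ j → total-indicator j e) ⟩
        sum {k} (λ _ → k ^ n)
          ≡⟨ sum-const k (k ^ n) ⟩
        k * k ^ n ∎

  -- Conditional expectations: the colours are fixed one vertex at a time, each so that the average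
  -- over the remaining choices does not rise.
  belowTotal : ∀ {k} n (f : Vec (Fin (suc k)) n → ℕ) → ∃[ c ] suc k ^ n * f c ≤ total n f
  belowTotal     zero    f = [] , ≤-reflexive (*-identityˡ _)
  belowTotal {k} (suc n) f with belowAverage (λ x → total n (f ∘ (x ∷_)))
  ... | x , p with belowTotal n (f ∘ (x ∷_))
  ...   | c , q = x ∷ c , (begin
    suc k * suc k ^ n * f (x ∷ c)    ≡⟨ *-assoc (suc k) (suc k ^ n) _ ⟩
    suc k * (suc k ^ n * f (x ∷ c))  ≤⟨ *-monoʳ-≤ (suc k) q ⟩
    suc k * total n (f ∘ (x ∷_))     ≤⟨ p ⟩
    total (suc n) f                  ∎)
    where open ≤-Reasoning

  -- The first-moment method: in a uniformly random colouring an edge of size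
  -- d + 1 is monochromatic with probability k⁻ᵈ.
  fewMonochromatic : ∀ {n d} k .{{_ : NonZero k}} (L : List (Subset n)) → All (λ e → ∣ e ∣ ≡ suc d) L →
                     ∃[ c ] monoCount {k} L c * k ^ d ≤ length L
  fewMonochromatic {n} {d} k@(suc _) L all with belowTotal n (monoCount L)
  ... | c , p = c , *-cancelʳ-≤ _ _ (k * k ^ n) {{m*n≢0 k (k ^ n) {{_}} {{m^n≢0 k n}}}} (begin
    monoCount L c * k ^ d * (k * k ^ n)    ≡⟨ shuffle (monoCount L c) (k ^ d) k (k ^ n) ⟩
    k ^ n * monoCount L c * (k * k ^ d)    ≤⟨ *-monoˡ-≤ (k * k ^ d) p ⟩
    total n (monoCount L) * k ^ suc d      ≡⟨ total-monoCount L all ⟩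
    length L * (k * k ^ n)                 ∎)
    where
    open ≤-Reasoning
    shuffle : ∀ a b c d → a * b * (c * d) ≡ d * a * (c * b)
    shuffle = solve-∀

  -- Hitting the monochromatic edges.

  ∣p∣>0⇒nonempty : ∀ {n} (p : Subset n) → 0 < ∣ p ∣ → Nonempty p
  ∣p∣>0⇒nonempty {n} p 0<∣p∣ with nonempty? p
  ... | yes ne = ne
  ... | no ¬ne = contradiction (subst (λ q → 0 < ∣ q ∣) (Empty-unique ¬ne) 0<∣p∣)
                               (λ lt → <-irrefl (sym (∣⊥∣≡0 n)) lt)

  ∣p∪q∣≤∣p∣+∣q∣ : ∀ {n} (p q : Subset n) → ∣ p ∪ q ∣ ≤ ∣ p ∣ + ∣ q ∣
  ∣p∪q∣≤∣p∣+∣q∣ []            []            = z≤n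
  ∣p∪q∣≤∣p∣+∣q∣ (outside ∷ p) (outside ∷ q) = ∣p∪q∣≤∣p∣+∣q∣ p q
  ∣p∪q∣≤∣p∣+∣q∣ (outside ∷ p) (inside  ∷ q) =
    ≤-trans (s≤s (∣p∪q∣≤∣p∣+∣q∣ p q)) (≤-reflexive (sym (+-suc _ _)))
  ∣p∪q∣≤∣p∣+∣q∣ (inside  ∷ p) (outside ∷ q) = s≤s (∣p∪q∣≤∣p∣+∣q∣ p q)
  ∣p∪q∣≤∣p∣+∣q∣ (inside  ∷ p) (inside  ∷ q) =
    s≤s (≤-trans (∣p∪q∣≤∣p∣+∣q∣ p q) (+-monoʳ-≤ ∣ p ∣ (n≤1+n _)))

  -- One vertex is taken from every monochromatic edge of `L`; the size `suc d` provides it, and the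
  -- indicator of that edge pays for it.
  transversal : ∀ {k n d} (L : List (Subset n)) → All (λ e → ∣ e ∣ ≡ suc d) L → (c : Vec (Fin k) n) →
                ∃[ R ] ∣ R ∣ ≤ monoCount L c ×
                  (∀ {e} → e ∈ˡ L → ∀ j → (∀ {i} → i ∈ e → lookup c i ≡ j) → Nonempty (e ∩ R))
  transversal {n = n} [] [] c = ⊥ , ≤-reflexive (∣⊥∣≡0 n) , λ ()
  transversal {k} {n} (e ∷ L) (∣e∣ ∷ all) c
    with transversal L all c | Fin.any? (λ j → Lift? (λ i → lookup c i Fin.≟ j) e)
  ... | R , ∣R∣≤ , hits | no ¬mono = R , ≤-trans ∣R∣≤ (m≤n+m _ _) , hits′
    where
    hits′ : ∀ {e′} → e′ ∈ˡ e ∷ L → ∀ j → (∀ {i} → i ∈ e′ → lookup c i ≡ j) → Nonempty (e′ ∩ R)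
    hits′ (here refl) j mono = ⊥-elim (¬mono (j , mono))
    hits′ (there e′∈) j mono = hits e′∈ j mono
  ... | R , ∣R∣≤ , hits | yes (j , mono) = ⁅ v ⁆ ∪ R , size , hits′
    where
    v = proj₁ (∣p∣>0⇒nonempty e (subst (0 <_) (sym ∣e∣) z<s))
    v∈e = proj₂ (∣p∣>0⇒nonempty e (subst (0 <_) (sym ∣e∣) z<s))
    size : ∣ ⁅ v ⁆ ∪ R ∣ ≤ sum (λ j → indicator j e c) + monoCount L c
    size = ≤-trans (∣p∪q∣≤∣p∣+∣q∣ ⁅ v ⁆ R)
             (+-mono-≤ (≤-trans (≤-reflexive (trans (∣⁅x⁆∣≡1 v) (sym (indicator-mono j e c mono))))
                                (term≤sum (λ j → indicator j e c) j))
                       ∣R∣≤)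
    hits′ : ∀ {e′} → e′ ∈ˡ e ∷ L → ∀ j → (∀ {i} → i ∈ e′ → lookup c i ≡ j) → Nonempty (e′ ∩ (⁅ v ⁆ ∪ R))
    hits′ (here refl) j mono = v , x∈p∩q⁺ (v∈e , x∈p∪q⁺ (inj₁ (x∈⁅x⁆ v)))
    hits′ (there e′∈) j mono with hits e′∈ j mono
    ... | u , u∈ with x∈p∩q⁻ _ R u∈
    ...   | u∈e , u∈R = u , x∈p∩q⁺ (u∈e , x∈p∪q⁺ (inj₂ u∈R))

  -- Vertex degrees and the greedy choice of a colour.

  bit : Side → ℕ
  bit inside  = 1
  bit outside = 0

  degree : ∀ {n} → Fin n → List (Subset n) → ℕ
  degree v []      = 0
  degree v (e ∷ L) = bit (lookup e v) + degree v L

  sum-bit : ∀ {n} (e : Subset n) → sum (λ v → bit (lookup e v)) ≡ ∣ e ∣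
  sum-bit []            = refl
  sum-bit (outside ∷ e) = sum-bit e
  sum-bit (inside  ∷ e) = cong suc (sum-bit e)

  sum-degree : ∀ {n d} (L : List (Subset n)) → All (λ e → ∣ e ∣ ≡ d) L → sum (λ v → degree v L) ≡ length L * d
  sum-degree {n} []      []           = trans (sum-const n 0) (*-zeroʳ n)
  sum-degree {n} (e ∷ L) (refl ∷ all) =
    trans (∑-distrib-+ {n} (λ v → bit (lookup e v)) (λ v → degree v L)) (cong₂ _+_ (sum-bit e) (sum-degree L all))

  card*min≤sum : ∀ {n a} (W : Subset n) (g : Vector ℕ n) → (∀ v → v ∈ W → a ≤ g v) → ∣ W ∣ * a ≤ sum g
  card*min≤sum []            g a≤ = z≤n
  card*min≤sum (outside ∷ W) g a≤ =
    ≤-trans (card*min≤sum W (g ∘ suc) (λ v v∈ → a≤ (suc v) (there v∈))) (m≤n+m _ _)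
  card*min≤sum (inside  ∷ W) g a≤ =
    +-mono-≤ (a≤ zero here) (card*min≤sum W (g ∘ suc) (λ v v∈ → a≤ (suc v) (there v∈)))

  -- If every colour occurred in `F`, choosing a position for each would send `k` colours to fewer
  -- positions, and two of them would share one.
  fresh : ∀ {k} (F : List (Fin k)) → length F < k → ∃[ x ] x ∉ˡ F
  fresh {k} F ∣F∣<k = Fin.¬∀⟶∃¬ k (_∈ˡ F) (_∈ˡ? F) notAll
    where
    open DecMembership (Fin._≟_ {k}) using () renaming (_∈?_ to _∈ˡ?_)
    notAll : ¬ (∀ x → x ∈ˡ F)
    notAll all with Fin.pigeonhole ∣F∣<k (λ x → Any.index (all x))
    ... | i , j , i<j , eq = Fin.<⇒≢ i<j
      (trans (Any.lookup-index (all i)) (trans (cong (List.lookup F) eq) (sym (Any.lookup-index (all j)))))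

  otherElement : ∀ {n} (e : Subset n) v → 1 < ∣ e ∣ → ∃[ u ] u ∈ e × u ≢ v
  otherElement {n} e v 1<∣e∣ with Fin.any? (λ u → (u ∈? e) ×-dec ¬? (u Fin.≟ v))
  ... | yes found = found
  ... | no ¬found = contradiction 1<∣e∣ (≤⇒≯ (subst (∣ e ∣ ≤_) (∣⁅x⁆∣≡1 v) (p⊆q⇒∣p∣≤∣q∣ e⊆⁅v⁆)))
    where
    e⊆⁅v⁆ : e ⊆ ⁅ v ⁆
    e⊆⁅v⁆ {u} u∈e with u Fin.≟ v
    ... | yes refl = x∈⁅x⁆ v
    ... | no u≢v = contradiction (u , u∈e , u≢v) ¬found

  -- To keep an edge through `v` from becoming monochromatic it suffices that `v` avoids the colour
  -- of one other vertex of it. So each such edge forbids a single colour.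
  forbidden : ∀ {n k d} → 1 ≤ d → (c : Fin n → Fin k) → ∀ v (L : List (Subset n)) → All (λ e → ∣ e ∣ ≡ suc d) L →
              ∃[ F ] length F ≤ degree v L × (∀ {e} → e ∈ˡ L → v ∈ e → ∃[ u ] u ∈ e × u ≢ v × c u ∈ˡ F)
  forbidden 1≤d c v []      []          = [] , z≤n , λ ()
  forbidden 1≤d c v (e ∷ L) (∣e∣ ∷ all) with forbidden 1≤d c v L all | lookup e v in eq
  ... | F , ∣F∣≤ , bad | outside = F , ∣F∣≤ , bad′
    where
    bad′ : ∀ {e′} → e′ ∈ˡ e ∷ L → v ∈ e′ → ∃[ u ] u ∈ e′ × u ≢ v × c u ∈ˡ F
    bad′ (here refl) v∈e = contradiction (trans (sym ([]=⇒lookup v∈e)) eq) (λ ())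
    bad′ (there e′∈) v∈  = bad e′∈ v∈
  ... | F , ∣F∣≤ , bad | inside with otherElement e v (subst (1 <_) (sym ∣e∣) (s≤s 1≤d))
  ...   | u , u∈e , u≢v = c u ∷ F , s≤s ∣F∣≤ , bad′
    where
    bad′ : ∀ {e′} → e′ ∈ˡ e ∷ L → v ∈ e′ → ∃[ w ] w ∈ e′ × w ≢ v × c w ∈ˡ c u ∷ F
    bad′ (here refl) _ = u , u∈e , u≢v , here refl
    bad′ (there e′∈) v∈ with bad e′∈ v∈
    ... | w , w∈ , w≢v , cw∈ = w , w∈ , w≢v , there cw∈

  -- Subsets of bounded size.

  smallSubsets : ∀ {n} → Subset n → ℕ → List (Subset n)
  smallSubsets []            s       = [] ∷ []
  smallSubsets (outside ∷ W) s       = List.map (outside ∷_) (smallSubsets W s)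
  smallSubsets (inside  ∷ W) zero    = List.map (outside ∷_) (smallSubsets W zero)
  smallSubsets (inside  ∷ W) (suc s) =
    List.map (outside ∷_) (smallSubsets W (suc s)) List.++ List.map (inside ∷_) (smallSubsets W s)

  -- By Pascal's rule: with `w` the size of the tail, the two lists together have length at most
  -- `(w + 2) * (w + 1) ^ s`.
  length-smallSubsets : ∀ {n} (W : Subset n) s → length (smallSubsets W s) ≤ suc ∣ W ∣ ^ s
  length-smallSubsets []            s       = ≤-reflexive (sym (^-zeroˡ s))
  length-smallSubsets (outside ∷ W) s       = ≤-trans (≤-reflexive (length-map _ (smallSubsets W s))) (length-smallSubsets W s)
  length-smallSubsets (inside  ∷ W) zero    = ≤-trans (≤-reflexive (length-map _ (smallSubsets W zero))) (length-smallSubsets W zero)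
  length-smallSubsets (inside  ∷ W) (suc s) = begin
    length (List.map (outside ∷_) (smallSubsets W (suc s)) List.++ List.map (inside ∷_) (smallSubsets W s))
      ≡⟨ length-++ (List.map (outside ∷_) (smallSubsets W (suc s))) ⟩
    length (List.map (outside ∷_) (smallSubsets W (suc s))) + length (List.map (inside ∷_) (smallSubsets W s))
      ≡⟨ cong₂ _+_ (length-map _ (smallSubsets W (suc s))) (length-map _ (smallSubsets W s)) ⟩
    length (smallSubsets W (suc s)) + length (smallSubsets W s)
      ≤⟨ +-mono-≤ (length-smallSubsets W (suc s)) (length-smallSubsets W s) ⟩
    suc w * suc w ^ s + suc w ^ s
      ≡⟨ +-comm (suc w * suc w ^ s) (suc w ^ s) ⟩
    suc (suc w) * suc w ^ s
      ≤⟨ *-monoʳ-≤ (suc (suc w)) (^-monoˡ-≤ s (n≤1+n (suc w))) ⟩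
    suc (suc w) * suc (suc w) ^ s ∎
    where
    open ≤-Reasoning
    w = ∣ W ∣

  ∈-smallSubsets : ∀ {n s} (A W : Subset n) → A ⊆ W → ∣ A ∣ ≤ s → A ∈ˡ smallSubsets W s
  ∈-smallSubsets []            []            A⊆W ∣A∣≤s = here refl
  ∈-smallSubsets (outside ∷ A) (outside ∷ W) A⊆W ∣A∣≤s = ∈ˡ.∈-map⁺ _ (∈-smallSubsets A W (drop-∷-⊆ A⊆W) ∣A∣≤s)
  ∈-smallSubsets (inside  ∷ A) (outside ∷ W) A⊆W ∣A∣≤s with () ← A⊆W here
  ∈-smallSubsets {s = zero}  (outside ∷ A) (inside ∷ W) A⊆W ∣A∣≤s = ∈ˡ.∈-map⁺ _ (∈-smallSubsets A W (drop-∷-⊆ A⊆W) ∣A∣≤s)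
  ∈-smallSubsets {s = suc s} (outside ∷ A) (inside ∷ W) A⊆W ∣A∣≤s =
    ∈ˡ.∈-++⁺ˡ (∈ˡ.∈-map⁺ _ (∈-smallSubsets A W (drop-∷-⊆ A⊆W) ∣A∣≤s))
  ∈-smallSubsets {s = suc s} (inside ∷ A) (inside ∷ W) A⊆W (s≤s ∣A∣≤s) =
    ∈ˡ.∈-++⁺ʳ (List.map (outside ∷_) (smallSubsets W (suc s))) (∈ˡ.∈-map⁺ _ (∈-smallSubsets A W (drop-∷-⊆ A⊆W) ∣A∣≤s))

  -- Arithmetic of the number of colours.

  power-between : ∀ b n → 2 ≤ b → ∃[ q ] suc n ≤ b ^ q × b ^ q ≤ b * suc n
  power-between b zero    2≤b = 0 , ≤-refl , ≤-trans (<⇒≤ 2≤b) (≤-reflexive (sym (*-identityʳ b)))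
  power-between b (suc n) 2≤b with power-between b n 2≤b
  ... | q , n≤ , ≤bn with suc (suc n) ≤? b ^ q
  ...   | yes n<  = q , n< , ≤-trans ≤bn (*-monoʳ-≤ b (n≤1+n _))
  ...   | no  n≮ = suc q , (begin
      suc (suc n)    ≤⟨ s≤s (s≤s (≤-trans (m≤m+n n _) (m≤n+m (n + 0) n))) ⟩
      suc (suc (n + (n + 0)))  ≡⟨ shuffle n ⟩
      2 * suc n      ≤⟨ *-mono-≤ 2≤b n≤ ⟩
      b * b ^ q      ∎) , *-monoʳ-≤ b (≤-trans (s≤s⁻¹ (≰⇒> n≮)) (n≤1+n _))
    where
    open ≤-Reasoning
    shuffle : ∀ n → suc (suc (n + (n + 0))) ≡ 2 * suc n
    shuffle = solve-∀

  ^-^-comm : ∀ b m n → (b ^ m) ^ n ≡ (b ^ n) ^ m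
  ^-^-comm b m n = trans (^-*-assoc b m n) (trans (cong (b ^_) (*-comm m n)) (sym (^-*-assoc b n m)))

  ^-distribʳ-* : ∀ k m n → (m * n) ^ k ≡ m ^ k * n ^ k
  ^-distribʳ-* zero    m n = refl
  ^-distribʳ-* (suc k) m n = trans (cong (m * n *_) (^-distribʳ-* k m n)) (shuffle m n (m ^ k) (n ^ k))
    where
    shuffle : ∀ a b c d → a * b * (c * d) ≡ a * c * (b * d)
    shuffle = solve-∀

  -- The exponent makes `palette r ^ d` at least `2 ^ (2 + r + d)` for positive `d`, which is what
  -- one round needs to shrink the bound on the vertex count by the factor `2 ^ d`.
  palette : ℕ → ℕ
  palette r = 2 ^ (3 + r)

  -- Here `x` is the number of vertices left after one round. With `Y = (2 ^ d) ^ suc q`, the power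
  -- of 2 in the number of colours is the `d`-th root of `Y ^ r`, so `Y ^ r` cancels and a single
  -- factor `Y` remains to be compared with the constants.
  remainder-bound : ∀ {d r q w x} → 1 ≤ d → w ≤ (2 ^ d) ^ suc q →
                    x * (palette r * (2 ^ r) ^ suc q) ^ d ≤ 2 * suc w ^ suc r → x ≤ (2 ^ d) ^ q
  remainder-bound {d} {r} {q} {w} {x} 1≤d w≤ x* =
    *-cancelʳ-≤ x _ (K ^ d) {{m^n≢0 K d {{m^n≢0 2 (3 + r)}}}}
      (*-cancelʳ-≤ _ _ (Y ^ r) {{m^n≢0 Y r {{Y≢0}}}} (begin
        x * K ^ d * Y ^ r                      ≡⟨ *-assoc x (K ^ d) (Y ^ r) ⟩
        x * (K ^ d * Y ^ r)                    ≡⟨ cong (λ y → x * (K ^ d * y)) Y^r ⟩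
        x * (K ^ d * ((2 ^ r) ^ suc q) ^ d)    ≡⟨ cong (x *_) (sym (^-distribʳ-* d K ((2 ^ r) ^ suc q))) ⟩
        x * (K * (2 ^ r) ^ suc q) ^ d          ≤⟨ x* ⟩
        2 * suc w ^ suc r                      ≤⟨ *-monoʳ-≤ 2 (^-monoˡ-≤ (suc r) 1+w≤) ⟩
        2 * (2 * Y) ^ suc r                    ≡⟨ cong (2 *_) (^-distribʳ-* (suc r) 2 Y) ⟩
        2 * (2 ^ suc r * (Y * Y ^ r))          ≡⟨ shuffle 2 (2 ^ suc r) (2 ^ d) ((2 ^ d) ^ q) (Y ^ r) ⟩
        (2 ^ d) ^ q * (2 * 2 ^ suc r * 2 ^ d) * Y ^ r
          ≡⟨ cong (λ y → (2 ^ d) ^ q * y * Y ^ r) (sym (^-distribˡ-+-* 2 (2 + r) d)) ⟩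
        (2 ^ d) ^ q * 2 ^ (2 + r + d) * Y ^ r
          ≤⟨ *-monoˡ-≤ (Y ^ r) (*-monoʳ-≤ ((2 ^ d) ^ q) (^-monoʳ-≤ 2 exponent)) ⟩
        (2 ^ d) ^ q * 2 ^ ((3 + r) * d) * Y ^ r
          ≡⟨ cong (λ y → (2 ^ d) ^ q * y * Y ^ r) (sym (^-*-assoc 2 (3 + r) d)) ⟩
        (2 ^ d) ^ q * K ^ d * Y ^ r ∎))
    where
    open ≤-Reasoning
    K = palette r
    Y = (2 ^ d) ^ suc q
    Y≢0 : NonZero Y
    Y≢0 = m^n≢0 (2 ^ d) (suc q) {{m^n≢0 2 d}}
    Y^r : Y ^ r ≡ ((2 ^ r) ^ suc q) ^ d
    Y^r = trans (^-^-comm (2 ^ d) (suc q) r)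
            (trans (cong (_^ suc q) (^-^-comm 2 d r)) (^-^-comm (2 ^ r) d (suc q)))
    1+w≤ : suc w ≤ 2 * Y
    1+w≤ = +-mono-≤ (>-nonZero⁻¹ Y {{Y≢0}}) (≤-trans w≤ (m≤m+n Y 0))
    shuffle : ∀ a b c d e → a * (b * (c * d * e)) ≡ d * (a * b * c) * e
    shuffle = solve-∀
    exponent : 2 + r + d ≤ (3 + r) * d
    exponent = ≤-trans (≤-reflexive (+-comm (2 + r) d)) (+-monoʳ-≤ d (m≤m*n (2 + r) d {{>-nonZero 1≤d}}))

  -- For `w = (2 ^ d) ^ q` vertices the factor `(2 ^ r) ^ q` is `w ^ (r / d)`. The final 1 serves a
  -- set of at most one vertex.
  colours : ℕ → ℕ → ℕ
  colours r zero    = 1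
  colours r (suc q) = palette r * (2 ^ r) ^ suc q + colours r q

  -- A geometric sum: for the exponent `suc r` the ratio `2 ^ suc r` is at least 2. For the exponent
  -- 0 the ratio would be 1, so that case is coloured greedily instead.
  colours≤ : ∀ r q → colours (suc r) q ≤ 2 * palette (suc r) * (2 ^ suc r) ^ q
  colours≤ r zero    = ≤-trans (m^n>0 2 (5 + r)) (≤-reflexive (sym (*-identityʳ (2 ^ (5 + r)))))
  colours≤ r (suc q) = begin
    K * (X * X ^ q) + colours (suc r) q     ≤⟨ +-monoʳ-≤ _ (colours≤ r q) ⟩
    K * (X * X ^ q) + 2 * K * X ^ q         ≡⟨ cong (K * (X * X ^ q) +_) (shuffle 2 K (X ^ q)) ⟩
    K * (X * X ^ q) + K * (2 * X ^ q)       ≤⟨ +-monoʳ-≤ _ (*-monoʳ-≤ K (*-monoˡ-≤ (X ^ q) 2≤X)) ⟩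
    K * (X * X ^ q) + K * (X * X ^ q)       ≡⟨ double K (X * X ^ q) ⟩
    2 * K * (X * X ^ q)                     ∎
    where
    open ≤-Reasoning
    K = palette (suc r)
    X = 2 ^ suc r
    2≤X : 2 ≤ X
    2≤X = *-monoʳ-≤ 2 (m^n>0 2 r)
    shuffle : ∀ a b c → a * b * c ≡ b * (a * c)
    shuffle = solve-∀
    double : ∀ a b → a * b + a * b ≡ 2 * a * b
    double = solve-∀

  -- For the exponent 0 this is one more than the degree bound `4 * suc d`. Otherwise the factor 2
  -- comes from the geometric sum and `2 ^ suc r` from rounding `n` up to a power of `2 ^ d`.
  chromaticConstant : ℕ → ℕ → ℕ
  chromaticConstant d zero    = suc (4 * suc d)
  chromaticConstant d (suc r) = 2 * palette (suc r) * 2 ^ suc r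

  chromatic-arith : ∀ d r q n → (2 ^ d) ^ q ≤ 2 ^ d * n →
                    colours (suc r) q ^ d ≤ chromaticConstant d (suc r) ^ d * n ^ suc r
  chromatic-arith d r q n B^q≤ = begin
    colours (suc r) q ^ d               ≤⟨ ^-monoˡ-≤ d (colours≤ r q) ⟩
    (2K * X ^ q) ^ d                    ≡⟨ ^-distribʳ-* d 2K (X ^ q) ⟩
    2K ^ d * (X ^ q) ^ d                ≡⟨ cong (2K ^ d *_) flip ⟩
    2K ^ d * ((2 ^ d) ^ q) ^ suc r      ≤⟨ *-monoʳ-≤ (2K ^ d) (^-monoˡ-≤ (suc r) B^q≤) ⟩
    2K ^ d * (2 ^ d * n) ^ suc r        ≡⟨ cong (2K ^ d *_) (^-distribʳ-* (suc r) (2 ^ d) n) ⟩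
    2K ^ d * ((2 ^ d) ^ suc r * n ^ suc r) ≡⟨ cong (λ y → 2K ^ d * (y * n ^ suc r)) (^-^-comm 2 d (suc r)) ⟩
    2K ^ d * (X ^ d * n ^ suc r)        ≡⟨ sym (*-assoc (2K ^ d) (X ^ d) (n ^ suc r)) ⟩
    2K ^ d * X ^ d * n ^ suc r          ≡⟨ cong (_* n ^ suc r) (sym (^-distribʳ-* d 2K X)) ⟩
    (2K * X) ^ d * n ^ suc r            ∎
    where
    open ≤-Reasoning
    2K = 2 * palette (suc r)
    X = 2 ^ suc r
    flip : (X ^ q) ^ d ≡ ((2 ^ d) ^ q) ^ suc r
    flip = trans (^-^-comm X q d) (trans (cong (_^ q) (^-^-comm 2 (suc r) d)) (^-^-comm (2 ^ d) (suc r) q))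

  -- Colourings from a bound on the edges inside every vertex set.

  module Colouring {n ℓ} (Edge : Pred (Subset n) ℓ) {d r : ℕ} (1≤d : 1 ≤ d)
    (cover : ∀ W → ∃[ L ] length L ≤ 2 * suc ∣ W ∣ ^ suc r × All (λ e → ∣ e ∣ ≡ suc d) L ×
                   (∀ {e} → Edge e → e ⊆ W → e ∈ˡ L)) where

    -- Only the edges inside `W` are constrained, while the colouring is defined everywhere; this
    -- allows recursion on vertex sets.
    Proper : ∀ {m} → Subset n → (Fin n → Fin m) → Set ℓ
    Proper W c = ∀ {e} → Edge e → e ⊆ W → ∀ k → ¬ (∀ i → i ∈ e → c i ≡ k)

    edge-size : ∀ {e} → Edge e → ∣ e ∣ ≡ suc d
    edge-size {e} Ee with cover e
    ... | L , _ , sizes , complete = All.lookup sizes (complete Ee id)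

    edge-nonempty : ∀ {e} → Edge e → Nonempty e
    edge-nonempty {e} Ee = ∣p∣>0⇒nonempty e (subst (0 <_) (sym (edge-size Ee)) z<s)

    -- `R` is a transversal of the edges left monochromatic by a good colouring with `k` colours,
    -- and its vertices are recoloured from a disjoint palette. A monochromatic edge that avoids `R`
    -- would have been hit by `R`; one that meets `R` has all its vertices in `R`, where the second
    -- colouring is proper.
    split : ∀ k .{{_ : NonZero k}} W → ∃[ R ] ∣ R ∣ * k ^ d ≤ 2 * suc ∣ W ∣ ^ suc r ×
            (∀ {m} (c : Fin n → Fin m) → Proper R c → Σ (Fin n → Fin (k + m)) (Proper W))
    split k W with cover W
    ... | L , ∣L∣≤ , sizes , complete with fewMonochromatic k L sizes
    ...   | c₁ , few with transversal L sizes c₁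
    ...     | R , ∣R∣≤ , hits = R , ≤-trans (*-monoˡ-≤ (k ^ d) ∣R∣≤) (≤-trans few ∣L∣≤) , extend
      where
      extend : ∀ {m} (c : Fin n → Fin m) → Proper R c → Σ (Fin n → Fin (k + m)) (Proper W)
      extend {m} c₂ proper = c , proper′
        where
        c : Fin n → Fin (k + m)
        c i with i ∈? R
        ... | yes _ = k ↑ʳ c₂ i
        ... | no  _ = lookup c₁ i ↑ˡ m
        c-∈ : ∀ {i} → i ∈ R → c i ≡ k ↑ʳ c₂ i
        c-∈ {i} i∈R with i ∈? R
        ... | yes _   = refl
        ... | no  i∉R = contradiction i∈R i∉R
        c-∉ : ∀ {i} → i ∉ R → c i ≡ lookup c₁ i ↑ˡ m
        c-∉ {i} i∉R with i ∈? R
        ... | yes i∈R = contradiction i∈R i∉R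
        ... | no  _   = refl
        disjoint : ∀ {x y} → k ↑ʳ y ≢ x ↑ˡ m
        disjoint {x} {y} eq
          with () ← trans (sym (Fin.splitAt-↑ʳ k m y)) (trans (cong (splitAt k) eq) (Fin.splitAt-↑ˡ k x m))
        proper′ : Proper W c
        proper′ {e} Ee e⊆W κ mono with nonempty? (e ∩ R)
        ... | yes (v , v∈) = proper Ee e⊆R (c₂ v) mono₂
          where
          v∈e = proj₁ (x∈p∩q⁻ e R v∈)
          cv≡ = trans (sym (mono v v∈e)) (c-∈ (proj₂ (x∈p∩q⁻ e R v∈)))
          e⊆R : e ⊆ R
          e⊆R {i} i∈e = decidable-stable (i ∈? R)
            (λ i∉R → disjoint (trans (sym cv≡) (trans (sym (mono i i∈e)) (c-∉ i∉R))))
          mono₂ : ∀ i → i ∈ e → c₂ i ≡ c₂ v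
          mono₂ i i∈e = Fin.↑ʳ-injective k _ _ (trans (sym (c-∈ (e⊆R i∈e))) (trans (mono i i∈e) cv≡))
        ... | no disj = disj (hits (complete Ee e⊆W) (lookup c₁ v) mono₁)
          where
          v = proj₁ (edge-nonempty Ee)
          ∉R : ∀ {i} → i ∈ e → i ∉ R
          ∉R i∈e i∈R = disj (_ , x∈p∩q⁺ (i∈e , i∈R))
          mono₁ : ∀ {i} → i ∈ e → lookup c₁ i ≡ lookup c₁ v
          mono₁ {i} i∈e = Fin.↑ˡ-injective m _ _
            (trans (sym (c-∉ (∉R i∈e))) (trans (mono i i∈e)
              (trans (sym (mono v v∈e)) (c-∉ (∉R v∈e)))))
            where v∈e = proj₂ (edge-nonempty Ee)

    -- Each round replaces `W` by the set still to be recoloured, whose size bound is smaller by the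
    -- factor `2 ^ d`; at the end `W` has at most one vertex and an edge has at least two.
    properByPeeling : ∀ q W → ∣ W ∣ ≤ (2 ^ d) ^ q → Σ (Fin n → Fin (colours r q)) (Proper W)
    properByPeeling zero    W ∣W∣≤1 = (λ _ → zero) , λ Ee e⊆W _ _ → <⇒≱ (s≤s 1≤d)
      (subst (_≤ 1) (edge-size Ee) (≤-trans (p⊆q⇒∣p∣≤∣q∣ e⊆W) ∣W∣≤1))
    properByPeeling (suc q) W ∣W∣≤
      with split (palette r * (2 ^ r) ^ suc q)
             {{m*n≢0 _ _ {{m^n≢0 2 (3 + r)}} {{m^n≢0 (2 ^ r) (suc q) {{m^n≢0 2 r}}}}}} W
    ... | R , ∣R∣* , extend with properByPeeling q R (remainder-bound {d} {r} {q} 1≤d ∣W∣≤ ∣R∣*)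
    ...   | c , proper = extend c proper

    -- Averaging: for `r = 0` there are at most `2 * (∣ W ∣ + 1)` listed edges, hence at most
    -- `4 * ∣ W ∣ * suc d` incidences, which is too few for every vertex of `W` to exceed the bound.
    lowDegree : r ≡ 0 → ∀ W → Nonempty W → ∃[ v ] v ∈ W × degree v (proj₁ (cover W)) ≤ 4 * suc d
    lowDegree refl W (w , w∈W) with cover W
    ... | L , ∣L∣≤ , sizes , _ with Fin.any? (λ v → (v ∈? W) ×-dec (degree v L ≤? 4 * suc d))
    ...   | yes found = found
    ...   | no ¬found = contradiction sum≤ (<⇒≱ (begin-strict
      sum (λ v → degree v L)       ≡⟨ sum-degree L sizes ⟩
      length L * suc d             ≤⟨ *-monoˡ-≤ (suc d) ∣L∣≤ ⟩
      2 * suc ∣ W ∣ ^ 1 * suc d     ≡⟨ cong (λ y → 2 * y * suc d) (^-identityʳ (suc ∣ W ∣)) ⟩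
      2 * suc ∣ W ∣ * suc d         ≤⟨ *-monoˡ-≤ (suc d) (*-monoʳ-≤ 2 (+-monoˡ-≤ ∣ W ∣ 0<∣W∣)) ⟩
      2 * (∣ W ∣ + ∣ W ∣) * suc d   ≡⟨ shuffle ∣ W ∣ (suc d) ⟩
      ∣ W ∣ * (4 * suc d)           <⟨ *-monoʳ-< ∣ W ∣ {{>-nonZero 0<∣W∣}} (n<1+n (4 * suc d)) ⟩
      ∣ W ∣ * suc (4 * suc d)       ∎))
      where
      open ≤-Reasoning
      shuffle : ∀ a b → 2 * (a + a) * b ≡ a * (4 * b)
      shuffle = solve-∀
      0<∣W∣ : 0 < ∣ W ∣
      0<∣W∣ = subst (_≤ ∣ W ∣) (∣⁅x⁆∣≡1 w)
        (p⊆q⇒∣p∣≤∣q∣ (λ u∈ → subst (_∈ W) (sym (x∈⁅y⁆⇒x≡y w u∈)) w∈W))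
      sum≤ : ∣ W ∣ * suc (4 * suc d) ≤ sum (λ v → degree v L)
      sum≤ = card*min≤sum W _ (λ v v∈W → ≰⇒> (λ deg≤ → ¬found (v , v∈W , deg≤)))

    -- A vertex of low degree is removed and coloured last; at most `4 * suc d` colours are then
    -- forbidden to it. The number `m` bounds the recursion.
    properByDegeneracy : r ≡ 0 → ∀ m W → ∣ W ∣ < m → Σ (Fin n → Fin (suc (4 * suc d))) (Proper W)
    properByDegeneracy r≡0 (suc m) W ∣W∣<m with nonempty? W
    ... | no empty = (λ _ → zero) , λ Ee e⊆W _ _ →
      empty (proj₁ (edge-nonempty Ee) , e⊆W (proj₂ (edge-nonempty Ee)))
    ... | yes nonempty with cover W | lowDegree r≡0 W nonempty
    ...   | L , _ , sizes , complete | v , v∈W , deg≤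
      with properByDegeneracy r≡0 m (W - v) (≤-trans (x∈p⇒∣p-x∣<∣p∣ v∈W) (s≤s⁻¹ ∣W∣<m))
    ...   | c , proper with forbidden 1≤d c v L sizes
    ...     | F , ∣F∣≤ , bad with fresh F (s≤s (≤-trans ∣F∣≤ deg≤))
    ...       | x , x∉F = c′ , proper′
      where
      c′ : Fin n → Fin (suc (4 * suc d))
      c′ i with i Fin.≟ v
      ... | yes _ = x
      ... | no  _ = c i
      c′-v : c′ v ≡ x
      c′-v with v Fin.≟ v
      ... | yes _   = refl
      ... | no  v≢v = contradiction refl v≢v
      c′-≢ : ∀ {i} → i ≢ v → c′ i ≡ c i
      c′-≢ {i} i≢v with i Fin.≟ v
      ... | yes i≡v = contradiction i≡v i≢v
      ... | no  _   = refl
      proper′ : Proper W c′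
      proper′ {e} Ee e⊆W κ mono with v ∈? e
      ... | yes v∈e with bad (complete Ee e⊆W) v∈e
      ...   | u , u∈e , u≢v , cu∈F = x∉F (subst (_∈ˡ F)
              (trans (sym (c′-≢ u≢v)) (trans (mono u u∈e) (trans (sym (mono v v∈e)) c′-v))) cu∈F)
      proper′ {e} Ee e⊆W κ mono | no v∉e = proper Ee
        (λ i∈e → x∈p∧x≢y⇒x∈p-y (e⊆W i∈e) (≢v i∈e)) κ
        (λ i i∈e → trans (sym (c′-≢ (≢v i∈e))) (mono i i∈e))
        where
        ≢v : ∀ {i} → i ∈ e → i ≢ v
        ≢v i∈e refl = v∉e i∈e

  fewColours : ∀ {ℓ d n} (Edge : Pred (Subset n) ℓ) → 1 ≤ d → ∀ r →
    (∀ W → ∃[ L ] length L ≤ 2 * suc ∣ W ∣ ^ suc r × All (λ e → ∣ e ∣ ≡ suc d) L ×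
                  (∀ {e} → Edge e → e ⊆ W → e ∈ˡ L)) →
    ∃[ m ] m ^ d ≤ chromaticConstant d r ^ d * n ^ r ×
           Σ (Fin n → Fin m) λ c → ∀ {e} → Edge e → ∀ k → ¬ (∀ i → i ∈ e → c i ≡ k)
  fewColours {d = d} {n} Edge 1≤d zero cover
    with Colouring.properByDegeneracy Edge 1≤d cover refl (suc n) ⊤ (s≤s (∣p∣≤n ⊤))
  ... | c , proper = _ , ≤-reflexive (sym (*-identityʳ _)) , c , λ Ee → proper Ee ⊆⊤
  -- For `n = 0` the bound is 0, so the palette has to be empty.
  fewColours {d = suc d} {zero} Edge 1≤d (suc r) cover = 0 , z≤n , (λ ()) , λ Ee ()
  fewColours {d = d} {suc n} Edge 1≤d (suc r) cover
    -- The vertex count is rounded up to a power of `2 ^ d`, where the rounds of peeling start.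
    with power-between (2 ^ d) n (≤-trans (≤-reflexive (sym (^-identityʳ 2))) (^-monoʳ-≤ 2 1≤d))
  ... | q , n≤ , ≤Bn with Colouring.properByPeeling Edge 1≤d cover q ⊤ (≤-trans (∣p∣≤n ⊤) n≤)
  ...   | c , proper = colours (suc r) q , chromatic-arith d r q (suc n) ≤Bn , c , λ Ee → proper Ee ⊆⊤

  -- Counting edges by the smaller of two parts.

  ∣p∩q∣+∣p∩∁q∣≡∣p∣ : ∀ {n} (p q : Subset n) → ∣ p ∩ q ∣ + ∣ p ∩ ∁ q ∣ ≡ ∣ p ∣
  ∣p∩q∣+∣p∩∁q∣≡∣p∣ []            []            = refl
  ∣p∩q∣+∣p∩∁q∣≡∣p∣ (outside ∷ p) (s       ∷ q) = ∣p∩q∣+∣p∩∁q∣≡∣p∣ p q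
  ∣p∩q∣+∣p∩∁q∣≡∣p∣ (inside  ∷ p) (outside ∷ q) = trans (+-suc _ _) (cong suc (∣p∩q∣+∣p∩∁q∣≡∣p∣ p q))
  ∣p∩q∣+∣p∩∁q∣≡∣p∣ (inside  ∷ p) (inside  ∷ q) = cong suc (∣p∩q∣+∣p∩∁q∣≡∣p∣ p q)

  -- `suc ⌊ d /2⌋` is half of `2 + d`, rounded down.
  smallHalf : ∀ d {a b} → a + b ≡ 2 + d → a ≤ suc ⌊ d /2⌋ ⊎ b ≤ suc ⌊ d /2⌋
  smallHalf d {a} {b} a+b≡ with a ≤? suc ⌊ d /2⌋ | b ≤? suc ⌊ d /2⌋
  ... | yes a≤ | _      = inj₁ a≤
  ... | no  _  | yes b≤ = inj₂ b≤
  ... | no  a≰ | no b≰  = contradiction (begin-strict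
      2 + d                              ≡⟨ cong (2 +_) (⌊n/2⌋+⌈n/2⌉≡n d) ⟨
      2 + (⌊ d /2⌋ + ⌈ d /2⌉)            ≤⟨ +-monoʳ-≤ 2 (+-monoʳ-≤ ⌊ d /2⌋ (⌊n/2⌋-mono (n≤1+n (suc d)))) ⟩
      2 + (⌊ d /2⌋ + suc ⌊ d /2⌋)        <⟨ +-monoʳ-< (2 + ⌊ d /2⌋) (n<1+n (suc ⌊ d /2⌋)) ⟩
      suc (suc ⌊ d /2⌋) + suc (suc ⌊ d /2⌋) ≤⟨ +-mono-≤ (≰⇒> a≰) (≰⇒> b≰) ⟩
      a + b                              ≡⟨ a+b≡ ⟩
      2 + d                              ∎) (<-irrefl refl)
    where open ≤-Reasoning

  module _ {n ℓ d} {Data : Pred (Subset n) ℓ} (size : ∀ {e} → Data e → ∣ e ∣ ≡ d) where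

    -- Since `σ` determines the edge, each set in `As` accounts for at most one edge, and `dec`
    -- tells whether there is one.
    representatives : (σ : ∀ {e} → Data e → Subset n) →
      (∀ {e e′} (f : Data e) (f′ : Data e′) → σ f ≡ σ f′ → e ≡ e′) →
      (∀ A → Dec (∃[ e ] Σ (Data e) λ f → σ f ≡ A)) → (As : List (Subset n)) →
      ∃[ L ] length L ≤ length As × All (λ e → ∣ e ∣ ≡ d) L × (∀ {e} (f : Data e) → σ f ∈ˡ As → e ∈ˡ L)
    representatives σ σ-inj dec []       = [] , z≤n , [] , λ f ()
    representatives σ σ-inj dec (A ∷ As) with representatives σ σ-inj dec As | dec A
    ... | L , ∣L∣≤ , sizes , complete | yes (e , f , σf≡A) = e ∷ L , s≤s ∣L∣≤ , size f ∷ sizes ,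
      λ { f′ (here σf′≡A) → here (σ-inj f′ f (trans σf′≡A (sym σf≡A))) ; f′ (there σf′∈) → there (complete f′ σf′∈) }
    ... | L , ∣L∣≤ , sizes , complete | no ¬A = L , m≤n⇒m≤1+n ∣L∣≤ , sizes ,
      λ { {e} f′ (here σf′≡A) → contradiction (e , f′ , σf′≡A) ¬A ; f′ (there σf′∈) → complete f′ σf′∈ }

    -- An edge inside `W` has one of its two parts among the small subsets of `W`, and either part
    -- determines it; the factor 2 counts the two parts.
    edgesInside : ∀ {s ℓ′} {Edge : Pred (Subset n) ℓ′} → (∀ {e} → Edge e → ¬ ¬ Data e) →
      (σ τ : ∀ {e} → Data e → Subset n) →
      (∀ {e} (f : Data e) → σ f ⊆ e) → (∀ {e} (f : Data e) → τ f ⊆ e) →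
      (∀ {e e′} (f : Data e) (f′ : Data e′) → σ f ≡ σ f′ → e ≡ e′) →
      (∀ {e e′} (f : Data e) (f′ : Data e′) → τ f ≡ τ f′ → e ≡ e′) →
      (∀ {e} (f : Data e) → ∣ σ f ∣ ≤ s ⊎ ∣ τ f ∣ ≤ s) →
      (∀ A → Dec (∃[ e ] Σ (Data e) λ f → σ f ≡ A)) → (∀ A → Dec (∃[ e ] Σ (Data e) λ f → τ f ≡ A)) →
      ∀ W → ∃[ L ] length L ≤ 2 * suc ∣ W ∣ ^ s × All (λ e → ∣ e ∣ ≡ d) L × (∀ {e} → Edge e → e ⊆ W → e ∈ˡ L)
    edgesInside {s} {Edge = Edge} data′ σ τ σ⊆ τ⊆ σ-inj τ-inj small decσ decτ W
      with representatives σ σ-inj decσ (smallSubsets W s) | representatives τ τ-inj decτ (smallSubsets W s)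
    ... | L₁ , ∣L₁∣≤ , sizes₁ , complete₁ | L₂ , ∣L₂∣≤ , sizes₂ , complete₂ =
      L₁ List.++ L₂ , length≤ , All.++⁺ sizes₁ sizes₂ , complete
      where
      open ≤-Reasoning
      length≤ : length (L₁ List.++ L₂) ≤ 2 * suc ∣ W ∣ ^ s
      length≤ = begin
        length (L₁ List.++ L₂)              ≡⟨ length-++ L₁ ⟩
        length L₁ + length L₂               ≤⟨ +-mono-≤ (≤-trans ∣L₁∣≤ (length-smallSubsets W s)) (≤-trans ∣L₂∣≤ (length-smallSubsets W s)) ⟩
        suc ∣ W ∣ ^ s + suc ∣ W ∣ ^ s         ≡⟨ cong (suc ∣ W ∣ ^ s +_) (+-identityʳ _) ⟨
        2 * suc ∣ W ∣ ^ s                    ∎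
      complete : ∀ {e} → Edge e → e ⊆ W → e ∈ˡ L₁ List.++ L₂
      -- Membership in a finite list is decidable, so doubly negated data of the edge suffice.
      complete {e} Ee e⊆W = decidable-stable (e ∈ˡ? (L₁ List.++ L₂)) λ e∉ → data′ Ee λ f →
        e∉ ([ (λ ≤s → ∈ˡ.∈-++⁺ˡ (complete₁ f (∈-smallSubsets (σ f) W (⊆-trans (σ⊆ f) e⊆W) ≤s)))
            , (λ ≤s → ∈ˡ.∈-++⁺ʳ L₁ (complete₂ f (∈-smallSubsets (τ f) W (⊆-trans (τ⊆ f) e⊆W) ≤s))) ]′ (small f))
        where open DecMembership (≡-dec Bool._≟_) using () renaming (_∈?_ to _∈ˡ?_)

-- Reasoning under double negation.

infixl 1 _>>=_
_>>=_ : ∀ {a b} {A : Set a} {B : Set b} → ¬ ¬ A → (A → ¬ ¬ B) → ¬ ¬ B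
(¬¬a >>= f) ¬b = ¬¬a (λ a → f a ¬b)

return : ∀ {a} {A : Set a} → A → ¬ ¬ A
return = contradiction

-- Double negation commutes with universal quantification over a finite type, since only finitely
-- many instances have to be combined.
¬¬-Fin : ∀ {a n} {P : Pred (Fin n) a} → (∀ i → ¬ ¬ P i) → ¬ ¬ (∀ i → P i)
¬¬-Fin = Fin.sequence (RawMonad.rawApplicative ¬¬-Monad)

¬¬-Subset : ∀ {a n} {P : Pred (Subset n) a} → (∀ p → ¬ ¬ P p) → ¬ ¬ (∀ p → P p)
¬¬-Subset {n = zero} ¬¬P = do
  P[] ← ¬¬P []
  return λ { [] → P[] }
¬¬-Subset {n = suc n} ¬¬P = do
  out ← ¬¬-Subset (λ p → ¬¬P (outside ∷ p))
  ins ← ¬¬-Subset (λ p → ¬¬P (inside ∷ p))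
  return λ { (outside ∷ p) → out p ; (inside ∷ p) → ins p }

¬∀⇒¬¬∃ : ∀ {a n} {P : Pred (Fin n) a} → ¬ (∀ i → P i) → ¬ ¬ (∃[ i ] ¬ P i)
¬∀⇒¬¬∃ ¬∀ ¬∃ = ¬¬-Fin (λ i ¬Pi → ¬∃ (i , ¬Pi)) ¬∀

-- Order, linear relations and lexicographic cones over the reals.

module OrderedField {c ℓ₁ ℓ₂ ℓ₃} (ℝ : Reals c ℓ₁ ℓ₂ ℓ₃) where
  open Reals ℝ hiding (zero)
  open CommutativeRing commutativeRing using (ring; commutativeSemiring)
  open RingProperties ring
  open SemiringSum semiring
  open Kronecker semiring
  open SemiringSolver commutativeSemiring using (solve; _:+_; _:*_; _:=_)
  open import Data.Unit.Polymorphic.Base using (⊤)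
  open IsStrictPartialOrder isStrictPartialOrder using (<-respʳ-≈; <-respˡ-≈; asym)
    renaming (irrefl to <-irrefl; trans to <-trans)
  open SetoidReasoning setoid

  -- Tightness makes equality equivalent to the negation of apartness, so equations can be taken out
  -- of a double negation.
  ≈-stable : ∀ {x y} → ¬ ¬ (x ≈ y) → x ≈ y
  ≈-stable {x} {y} ¬¬x≈y = proj₁ (tight x y) (λ x#y → ¬¬x≈y (λ x≈y → proj₂ (tight x y) x≈y x#y))

  ≉⇒¬¬# : ∀ {x y} → ¬ (x ≈ y) → ¬ ¬ (x # y)
  ≉⇒¬¬# {x} {y} x≉y ¬x#y = x≉y (proj₁ (tight x y) ¬x#y)

  trichotomy : ∀ x → ¬ ¬ (x < 0# ⊎ x ≈ 0# ⊎ 0# < x)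
  trichotomy x = do
    yes x#0 ← ¬¬-excluded-middle
      where no ¬x#0 → return (inj₂ (inj₁ (proj₁ (tight x 0#) ¬x#0)))
    return ([ inj₁ , inj₂ ∘ inj₂ ]′ (#⇒<⊎> x#0))

  ≤-antisym : ∀ {x y} → x ≤ y → y ≤ x → x ≈ y
  ≤-antisym {x} {y} x≤y y≤x = proj₁ (tight x y) (λ x#y → [ y≤x , x≤y ]′ (#⇒<⊎> x#y))

  ≤⇒¬¬< : ∀ {x y} → x ≤ y → ¬ (x ≈ y) → ¬ ¬ (x < y)
  ≤⇒¬¬< x≤y x≉y x≮y = x≉y (≤-antisym x≤y x≮y)

  ≤-reflexive : ∀ {x y} → x ≈ y → x ≤ y
  ≤-reflexive x≈y y<x = <-irrefl (sym x≈y) y<x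

  pos⇒0≤ : ∀ {x} → 0# < x → 0# ≤ x
  pos⇒0≤ = asym

  +-pos : ∀ {x y} → 0# < x → 0# < y → 0# < x + y
  +-pos {x} {y} 0<x 0<y = <-trans 0<y (<-respˡ-≈ (+-identityˡ y) (+-monoˡ-< y 0<x))

  neg⇒pos : ∀ {x} → x < 0# → 0# < - x
  neg⇒pos {x} x<0 = <-respˡ-≈ (-‿inverseʳ x) (<-respʳ-≈ (+-identityˡ (- x)) (+-monoˡ-< (- x) x<0))

  pos⇒neg : ∀ {x} → 0# < x → - x < 0#
  pos⇒neg {x} 0<x = <-respˡ-≈ (+-identityˡ (- x)) (<-respʳ-≈ (-‿inverseʳ x) (+-monoˡ-< (- x) 0<x))

  y-x<0⇒y<x : ∀ {x y} → y - x < 0# → y < x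
  y-x<0⇒y<x {x} {y} lt = <-respʳ-≈ (+-identityˡ x) (<-respˡ-≈ cancel (+-monoˡ-< x lt))
    where
    cancel : y - x + x ≈ y
    cancel = trans (+-assoc y (- x) x) (trans (+-congˡ (-‿inverseˡ x)) (+-identityʳ y))

  pos*neg : ∀ {x y} → 0# < x → y < 0# → x * y < 0#
  pos*neg {x} {y} 0<x y<0 = <-respˡ-≈ (-‿involutive (x * y))
    (pos⇒neg (<-respʳ-≈ (sym (-‿distribʳ-* x y)) (*-pos 0<x (neg⇒pos y<0))))

  -- Apartness is invertibility of the difference, and `1# - 0#` has the inverse `1#`.
  1#0 : 1# # 0#
  1#0 = invertible⇒# (1# , trans (*-identityˡ _) x-0≈x , trans (*-identityʳ _) x-0≈x)
    where
    x-0≈x : 1# - 0# ≈ 1#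
    x-0≈x = trans (+-congˡ -0#≈0#) (+-identityʳ 1#)

  -- If 1 were negative, then -1 would be positive, and so would be its square 1.
  0<1 : 0# < 1#
  0<1 = [ (λ 1<0 → contradiction
              (<-respʳ-≈ (trans (sym (-‿distribˡ-* 1# (- 1#))) (trans (-‿cong (*-identityˡ (- 1#))) (-‿involutive 1#)))
                 (*-pos (neg⇒pos 1<0) (neg⇒pos 1<0)))
              (asym 1<0))
          , id ]′ (#⇒<⊎> 1#0)

  1≉0 : ¬ (1# ≈ 0#)
  1≉0 1≈0 = <-irrefl (sym 1≈0) 0<1

  pos⇒≉0 : ∀ {x} → 0# < x → ¬ (x ≈ 0#)
  pos⇒≉0 0<x x≈0 = <-irrefl (sym x≈0) 0<x

  inverse : ∀ {x} → x # 0# → ∃[ y ] x * y ≈ 1#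
  inverse {x} x#0 with #⇒invertible x#0
  ... | y , _ , xy≈1 = y , trans (*-congʳ (sym (trans (+-congˡ -0#≈0#) (+-identityʳ x)))) xy≈1

  posInverse : ∀ {x} → 0# < x → ∃[ y ] 0# < y × x * y ≈ 1#
  posInverse {x} 0<x with inverse (#-sym (<⇒# 0<x))
  ... | y , xy≈1 = y , 0<y , xy≈1
    where
    y#0 : y # 0#
    y#0 = invertible⇒# (x , trans (*-congˡ y-0≈y) xy≈1 , trans (*-congʳ y-0≈y) (trans (*-comm y x) xy≈1))
      where
      y-0≈y : y - 0# ≈ y
      y-0≈y = trans (+-congˡ -0#≈0#) (+-identityʳ y)
    0<y : 0# < y
    0<y = [ (λ y<0 → contradiction (<-respˡ-≈ xy≈1 (pos*neg 0<x y<0)) (asym 0<1)) , id ]′ (#⇒<⊎> y#0)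

  *-cancelˡ-0 : ∀ {x y} → ¬ (x ≈ 0#) → x * y ≈ 0# → y ≈ 0#
  *-cancelˡ-0 {x} {y} x≉0 xy≈0 = ≈-stable do
    x#0 ← ≉⇒¬¬# x≉0
    let z , xz≈1 = inverse x#0
    return (begin
      y            ≈⟨ *-identityˡ y ⟨
      1# * y       ≈⟨ *-congʳ xz≈1 ⟨
      x * z * y    ≈⟨ solve 3 (λ x y z → x :* z :* y := z :* (x :* y)) refl x y z ⟩
      z * (x * y)  ≈⟨ *-congˡ xy≈0 ⟩
      z * 0#       ≈⟨ zeroʳ z ⟩
      0#           ∎)

  -- As `≤` is a negated strict inequality, the goal is a negation and doubly negated trichotomy may
  -- be used for it.
  0≤-+ : ∀ {x y} → 0# ≤ x → 0# ≤ y → 0# ≤ x + y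
  0≤-+ {x} {y} 0≤x 0≤y x+y<0 = trichotomy x λ
    { (inj₁ x<0) → 0≤x x<0
    ; (inj₂ (inj₁ x≈0)) → 0≤y (<-respˡ-≈ (trans (+-congʳ x≈0) (+-identityˡ y)) x+y<0)
    ; (inj₂ (inj₂ 0<x)) → 0≤y (<-trans (<-respˡ-≈ (+-identityˡ y) (+-monoˡ-< y 0<x)) x+y<0)
    }

  0≤-* : ∀ {x y} → 0# ≤ x → 0# ≤ y → 0# ≤ x * y
  0≤-* {x} {y} 0≤x 0≤y xy<0 = trichotomy x λ
    { (inj₁ x<0) → 0≤x x<0
    ; (inj₂ (inj₁ x≈0)) → <-irrefl (trans (*-congʳ x≈0) (zeroˡ y)) xy<0
    ; (inj₂ (inj₂ 0<x)) → trichotomy y λ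
      { (inj₁ y<0) → 0≤y y<0
      ; (inj₂ (inj₁ y≈0)) → <-irrefl (trans (*-congˡ y≈0) (zeroʳ x)) xy<0
      ; (inj₂ (inj₂ 0<y)) → asym xy<0 (*-pos 0<x 0<y)
      }
    }

  0≤-sum : ∀ {n} {f : Vector Carrier n} → (∀ i → 0# ≤ f i) → 0# ≤ sum f
  0≤-sum {zero}  0≤f = ≤-reflexive refl
  0≤-sum {suc n} 0≤f = 0≤-+ (0≤f zero) (0≤-sum (0≤f ∘ suc))

  0≤-+-zeroˡ : ∀ {x y} → 0# ≤ x → 0# ≤ y → x + y ≈ 0# → x ≈ 0#
  0≤-+-zeroˡ {x} {y} 0≤x 0≤y x+y≈0 = sym (≤-antisym 0≤x λ 0<x →
    0≤y (<-respˡ-≈ (+-identityˡ y) (<-respʳ-≈ x+y≈0 (+-monoˡ-< y 0<x))))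

  0≤-sum-zero : ∀ {n} {f : Vector Carrier n} → (∀ i → 0# ≤ f i) → sum f ≈ 0# → ∀ i → f i ≈ 0#
  0≤-sum-zero 0≤f Σ≈0 zero    = 0≤-+-zeroˡ (0≤f zero) (0≤-sum (0≤f ∘ suc)) Σ≈0
  0≤-sum-zero 0≤f Σ≈0 (suc i) = 0≤-sum-zero (0≤f ∘ suc)
    (0≤-+-zeroˡ (0≤-sum (0≤f ∘ suc)) (0≤f zero) (trans (+-comm _ _) Σ≈0)) i

  sum-ones-pos : ∀ {n} → Fin n → 0# < sum {n} (λ _ → 1#)
  sum-ones-pos {suc zero}    _ = <-respʳ-≈ (sym (+-identityʳ 1#)) 0<1
  sum-ones-pos {suc (suc n)} _ = +-pos 0<1 (sum-ones-pos {suc n} zero)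

  sum-swap : ∀ {m n} (t : Vector Carrier m) (M : Fin m → Vector Carrier n) (w : Vector Carrier n) →
             sum (λ j → sum (λ i → t i * M i j) * w j) ≈ sum (λ i → t i * sum (λ j → M i j * w j))
  sum-swap {m} {n} t M w = begin
    sum (λ j → sum (λ i → t i * M i j) * w j)     ≈⟨ sum-cong-≋ (λ j → *-distribʳ-sum (w j) (λ i → t i * M i j)) ⟩
    sum (λ j → sum (λ i → t i * M i j * w j))     ≈⟨ sum-cong-≋ (λ j → sum-cong-≋ (λ i → *-assoc (t i) (M i j) (w j))) ⟩
    sum (λ j → sum (λ i → t i * (M i j * w j)))   ≈⟨ ∑-comm (λ j i → t i * (M i j * w j)) ⟩
    sum (λ i → sum (λ j → t i * (M i j * w j)))   ≈⟨ sum-cong-≋ (λ i → *-distribˡ-sum (t i) (λ j → M i j * w j)) ⟨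
    sum (λ i → t i * sum (λ j → M i j * w j))     ∎

  sum-swap-ones : ∀ {m n} (t : Vector Carrier m) (M : Fin m → Vector Carrier n) →
                  sum (λ j → sum (λ i → t i * M i j)) ≈ sum (λ i → t i * sum (M i))
  sum-swap-ones t M = trans (∑-comm (λ j i → t i * M i j))
    (sym (sum-cong-≋ (λ i → *-distribˡ-sum (t i) (M i))))

  sum-neg : ∀ {n} (f : Vector Carrier n) → sum (λ i → - f i) ≈ - sum f
  sum-neg {zero}  f = sym -0#≈0#
  sum-neg {suc n} f = trans (+-congˡ (sum-neg (f ∘ suc))) (-‿+-comm (f zero) (sum (f ∘ suc)))

  -- Gaussian elimination: a nonzero entry of the first row is the pivot, its column is cleared from
  -- the other rows, and the support loses that column.
  nontrivialRelation : ∀ {m n} (e : Subset n) (T : Fin m → Vector Carrier n) →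
    (∀ i j → j ∉ e → T i j ≈ 0#) → ∣ e ∣ ℕ.< m →
    ¬ ¬ (Σ (Vector Carrier m) λ x → ¬ (∀ i → x i ≈ 0#) × (∀ j → sum (λ i → x i * T i j) ≈ 0#))
  nontrivialRelation {suc m} {n} e T supp ∣e∣<m = do
    no T₀≉0 ← ¬¬-excluded-middle {A = ∀ j → T zero j ≈ 0#}
      where
      yes T₀≈0 → return
        ( 1# ◂ (λ _ → 0#)
        , (λ x≈0 → 1≉0 (x≈0 zero))
        , λ j → trans (+-cong (trans (*-identityˡ _) (T₀≈0 j)) (sum-zero {n = m} (λ i → zeroˡ (T (suc i) j)))) (+-identityˡ 0#)
        )
    p , T₀p≉0 ← ¬∀⇒¬¬∃ T₀≉0
    T₀p#0 ← ≉⇒¬¬# T₀p≉0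
    let y , T₀py≈1 = inverse T₀p#0
        p∈e = decidable-stable (p Subset.∈? e) (λ p∉e → T₀p≉0 (supp zero p p∉e))
        T′ = λ (i : Fin m) j → T (suc i) j + - (T (suc i) p * y) * T zero j
    x , x≉0 , rel ← nontrivialRelation (e ∖ p) T′ (eliminated y T₀py≈1)
                      (ℕ.≤-trans (Subset.x∈p⇒∣p-x∣<∣p∣ p∈e) (ℕ.s≤s⁻¹ ∣e∣<m))
    return
      -- The first row collects the multiples of it that were added to the other rows.
      ( sum (λ i → x i * - (T (suc i) p * y)) ◂ x
      , (λ x≈0 → x≉0 (x≈0 ∘ suc))
      , λ j → trans (extend x (λ i → - (T (suc i) p * y)) j) (rel j)
      )
    where
    eliminated : ∀ {p} y → T zero p * y ≈ 1# → ∀ i j → j ∉ e ∖ p →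
                 T (suc i) j + - (T (suc i) p * y) * T zero j ≈ 0#
    eliminated {p} y T₀py≈1 i j j∉ with j Fin.≟ p
    ... | yes ≡.refl = begin
      T (suc i) p + - (T (suc i) p * y) * T zero p    ≈⟨ +-congˡ (-‿distribˡ-* _ _) ⟨
      T (suc i) p + - (T (suc i) p * y * T zero p)
        ≈⟨ +-congˡ (-‿cong (solve 3 (λ a b c → a :* b :* c := a :* (c :* b)) refl (T (suc i) p) y (T zero p))) ⟩
      T (suc i) p + - (T (suc i) p * (T zero p * y))  ≈⟨ +-congˡ (-‿cong (trans (*-congˡ T₀py≈1) (*-identityʳ _))) ⟩
      T (suc i) p + - T (suc i) p                     ≈⟨ -‿inverseʳ _ ⟩
      0#                                              ∎
    ... | no j≢p = trans (+-cong (supp (suc i) j j∉e) (trans (*-congˡ (supp zero j j∉e)) (zeroʳ _))) (+-identityˡ 0#)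
      where
      j∉e : j ∉ e
      j∉e j∈e = j∉ (Subset.x∈p∧x≢y⇒x∈p-y j∈e j≢p)
    extend : ∀ (x b : Vector Carrier m) j →
             sum (λ i → x i * b i) * T zero j + sum (λ i → x i * T (suc i) j) ≈
             sum (λ i → x i * (T (suc i) j + b i * T zero j))
    extend x b j = begin
      sum (λ i → x i * b i) * T zero j + sum (λ i → x i * T (suc i) j)
        ≈⟨ +-congʳ (*-distribʳ-sum (T zero j) (λ i → x i * b i)) ⟩
      sum (λ i → x i * b i * T zero j) + sum (λ i → x i * T (suc i) j)
        ≈⟨ ∑-distrib-+ (λ i → x i * b i * T zero j) (λ i → x i * T (suc i) j) ⟨
      sum (λ i → x i * b i * T zero j + x i * T (suc i) j)
        ≈⟨ sum-cong-≋ (λ i → solve 4 (λ x b s t → x :* b :* t :+ x :* s := x :* (s :+ b :* t)) refl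
                               (x i) (b i) (T (suc i) j) (T zero j)) ⟩
      sum (λ i → x i * (T (suc i) j + b i * T zero j)) ∎

  -- The cone of vectors whose first nonzero coordinate satisfies Pos.
  module Lex {p} (Pos : Pred Carrier p)
    (Pos-resp : ∀ {x y} → x ≈ y → Pos x → Pos y)
    (Pos-+    : ∀ {x y} → Pos x → Pos y → Pos (x + y))
    (Pos-*    : ∀ {x a} → Pos x → 0# < a → Pos (x * a))
    (¬Pos-0   : ¬ Pos 0#) where

    Cone : ∀ {n} → Vector Carrier n → Set (ℓ₁ ⊔ p)
    Cone {zero}  x = ⊤
    Cone {suc n} x = Pos (x zero) ⊎ (x zero ≈ 0# × Cone (x ∘ suc))

    Cone-zero : ∀ {n} {x : Vector Carrier n} → (∀ i → x i ≈ 0#) → Cone x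
    Cone-zero {zero}  x≈0 = _
    Cone-zero {suc n} x≈0 = inj₂ (x≈0 zero , Cone-zero (x≈0 ∘ suc))

    Cone-+ : ∀ {n} {x y : Vector Carrier n} → Cone x → Cone y → Cone (λ i → x i + y i)
    Cone-+ {zero}  _ _ = _
    Cone-+ {suc n} (inj₁ px)        (inj₁ py)        = inj₁ (Pos-+ px py)
    Cone-+ {suc n} (inj₁ px)        (inj₂ (y≈0 , _)) = inj₁ (Pos-resp (sym (trans (+-congˡ y≈0) (+-identityʳ _))) px)
    Cone-+ {suc n} (inj₂ (x≈0 , _)) (inj₁ py)        = inj₁ (Pos-resp (sym (trans (+-congʳ x≈0) (+-identityˡ _))) py)
    Cone-+ {suc n} (inj₂ (x≈0 , cx)) (inj₂ (y≈0 , cy)) =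
      inj₂ (trans (+-cong x≈0 y≈0) (+-identityˡ 0#) , Cone-+ cx cy)

    Cone-* : ∀ {n a} {x : Vector Carrier n} → Cone x → 0# < a → Cone (λ i → x i * a)
    Cone-* {zero}  _ _ = _
    Cone-* {suc n} (inj₁ px)        0<a = inj₁ (Pos-* px 0<a)
    Cone-* {suc n} (inj₂ (x≈0 , cx)) 0<a = inj₂ (trans (*-congʳ x≈0) (zeroˡ _) , Cone-* cx 0<a)

    Cone-sum : ∀ {m n} (f : Fin m → Vector Carrier n) → (∀ j → Cone (f j)) → Cone (λ i → sum (λ j → f j i))
    Cone-sum {zero}  f cf = Cone-zero (λ _ → refl)
    Cone-sum {suc m} f cf = Cone-+ (cf zero) (Cone-sum (f ∘ suc) (cf ∘ suc))

    Cone-weightedSum : ∀ {m n} (f : Fin m → Vector Carrier n) (a : Vector Carrier m) →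
      (∀ j → (∀ i → f j i ≈ 0#) ⊎ a j ≈ 0# ⊎ (Cone (f j) × 0# < a j)) → Cone (λ i → sum (λ j → f j i * a j))
    Cone-weightedSum f a terms = Cone-sum (λ j i → f j i * a j) λ j →
      [ (λ f≈0 → Cone-zero (λ i → trans (*-congʳ (f≈0 i)) (zeroˡ (a j))))
      , [ (λ a≈0 → Cone-zero (λ i → trans (*-congˡ a≈0) (zeroʳ (f j i))))
        , (λ { (cf , 0<a) → Cone-* cf 0<a }) ]′ ]′ (terms j)

    -- At the first coordinate where one of the vectors is nonzero the sum would satisfy `Pos`, yet
    -- it vanishes.
    Cone-pointed : ∀ {n} {x y : Vector Carrier n} → Cone x → Cone y → (∀ i → x i + y i ≈ 0#) → ∀ i → x i ≈ 0#
    Cone-pointed {suc n} (inj₁ px) (inj₁ py) x+y≈0 = contradiction (Pos-resp (x+y≈0 zero) (Pos-+ px py)) ¬Pos-0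
    Cone-pointed {suc n} (inj₁ px) (inj₂ (y≈0 , _)) x+y≈0 = contradiction
      (Pos-resp (trans (sym (trans (+-congˡ y≈0) (+-identityʳ _))) (x+y≈0 zero)) px) ¬Pos-0
    Cone-pointed {suc n} (inj₂ (x≈0 , _)) (inj₁ py) x+y≈0 = contradiction
      (Pos-resp (trans (sym (trans (+-congʳ x≈0) (+-identityˡ _))) (x+y≈0 zero)) py) ¬Pos-0
    Cone-pointed {suc n} (inj₂ (x≈0 , cx)) (inj₂ (y≈0 , cy)) x+y≈0 =
      λ { zero → x≈0 ; (suc i) → Cone-pointed cx cy (x+y≈0 ∘ suc) i }

  module Positive = Lex (0# <_) <-respʳ-≈ +-pos *-pos (<-irrefl refl)

  module Negative = Lex (_< 0#) <-respˡ-≈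
    (λ {x} {y} x<0 y<0 → <-trans (<-respʳ-≈ (+-identityˡ y) (+-monoˡ-< y x<0)) y<0)
    (λ {x} {a} x<0 0<a → <-respˡ-≈ (*-comm a x) (pos*neg 0<a x<0))
    (<-irrefl refl)

  lexTotal : ∀ {n} (x : Vector Carrier n) → ¬ ¬ (Positive.Cone x ⊎ Negative.Cone x)
  lexTotal {zero}  x = return (inj₁ _)
  lexTotal {suc n} x = do
    inj₂ (inj₁ x≈0) ← trichotomy (x zero)
      where
      inj₁ x<0        → return (inj₂ (inj₁ x<0))
      inj₂ (inj₂ 0<x) → return (inj₁ (inj₁ 0<x))
    inj₁ cx ← lexTotal (x ∘ suc)
      where inj₂ cx → return (inj₂ (inj₂ (x≈0 , cx)))
    return (inj₁ (inj₂ (x≈0 , cx)))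

enumerate : ∀ {n k} (e : Subset n) → k ℕ.≤ ∣ e ∣ →
            Σ (Fin k → Fin n) λ ι → (∀ i → ι i ∈ e) × (∀ {i j} → ι i ≡ ι j → i ≡ j)
enumerate {k = zero}  e             k≤ = (λ ()) , (λ ()) , λ { {()} }
enumerate {k = suc k} (outside ∷ e) k≤ with enumerate e k≤
... | ι , ι∈ , ι-inj = suc ∘ ι , there ∘ ι∈ , ι-inj ∘ Fin.suc-injective
enumerate {k = suc k} (inside ∷ e) (ℕ.s≤s k≤) with enumerate e k≤
... | ι , ι∈ , ι-inj =
  (λ { zero → zero ; (suc i) → suc (ι i) }) ,
  (λ { zero → here ; (suc i) → there (ι∈ i) }) ,
  λ { {zero} {zero} _ → ≡.refl ; {suc i} {suc j} eq → ≡.cong suc (ι-inj (Fin.suc-injective eq)) }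

-- Geometry of the facets of a polytope.

module FacetGeometry {c ℓ₁ ℓ₂ ℓ₃} (ℝ : Reals c ℓ₁ ℓ₂ ℓ₃) where
  open Reals ℝ hiding (zero)
  open Polytopes ℝ
  open OrderedField ℝ
  open CommutativeRing commutativeRing using (ring; commutativeSemiring)
  open RingProperties ring
  open SemiringSum semiring
  open Kronecker semiring
  open VectorEquality setoid using (_≋_; ≋-refl; ≋-sym; ≋-trans)
  open SemiringSolver commutativeSemiring using (solve; _:*_; _:=_)
  open SetoidReasoning setoid

  sum-δ-1 : ∀ {n} (i : Fin n) → sum (δ i) ≈ 1#
  sum-δ-1 {n} i = trans (sum-cong-≋ {n} (λ j → sym (*-identityʳ (δ i j)))) (sum-δ i (λ _ → 1#))

  δ-nonneg : ∀ {n} (i j : Fin n) → 0# ≤ δ i j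
  δ-nonneg i j with i Fin.≟ j
  ... | yes ≡.refl = ≡.subst (0# ≤_) (≡.sym (δ-refl i)) (pos⇒0≤ 0<1)
  ... | no i≢j = ≤-reflexive (reflexive (≡.sym (δ-≢ i≢j)))

  generator∈conv : ∀ {N n} (w : Vector (Point N) n) i → conv w (w i)
  generator∈conv w i = δ i , δ-nonneg i , sum-δ-1 i , λ k → sym (sum-δ i (λ j → w j k))

  -- Slacks, affine functionals and affine independence.

  module _ {N : ℕ} where

    slack : Point N → Carrier → Point N → Carrier
    slack a b x = b - ⟨ a , x ⟩

    sum-slack : ∀ {n} a b (t : Vector Carrier n) (w : Vector (Point N) n) →
                sum (λ i → t i * slack a b (w i)) ≈ sum t * b - ⟨ a , combination t w ⟩
    sum-slack {n} a b t w = begin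
      sum (λ i → t i * (b - ⟨ a , w i ⟩))
        ≈⟨ sum-cong-≋ {n} (λ i → x[y-z]≈xy-xz (t i) b ⟨ a , w i ⟩) ⟩
      sum (λ i → t i * b - t i * ⟨ a , w i ⟩)
        ≈⟨ ∑-distrib-+ {n} _ _ ⟩
      sum (λ i → t i * b) + sum (λ i → - (t i * ⟨ a , w i ⟩))
        ≈⟨ +-cong (sym (*-distribʳ-sum {n} b t)) (sum-neg {n} _) ⟩
      sum t * b - sum (λ i → t i * ⟨ a , w i ⟩)
        ≈⟨ +-congˡ (-‿cong inner) ⟩
      sum t * b - ⟨ a , combination t w ⟩ ∎
      where
      inner : sum (λ i → t i * ⟨ a , w i ⟩) ≈ ⟨ a , combination t w ⟩
      inner = begin
        sum (λ i → t i * sum (λ k → a k * w i k))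
          ≈⟨ sum-cong-≋ {n} (λ i → *-congˡ (sum-cong-≋ {N} (λ k → *-comm (a k) (w i k)))) ⟩
        sum (λ i → t i * sum (λ k → w i k * a k))
          ≈⟨ sum-swap t w a ⟨
        sum (λ k → combination t w k * a k)
          ≈⟨ sum-cong-≋ {N} (λ k → *-comm (combination t w k) (a k)) ⟩
        sum (λ k → a k * combination t w k) ∎

    slack-combination : ∀ {n} a b {t : Vector Carrier n} {w : Vector (Point N) n} {x} → sum t ≈ 1# →
                        x ≋ combination t w → slack a b x ≈ sum (λ i → t i * slack a b (w i))
    slack-combination a b {t} {w} {x} Σt≈1 x≋ = begin
      b - ⟨ a , x ⟩                          ≈⟨ +-cong (sym (*-identityˡ b)) (-‿cong (sum-cong-≋ {N} (λ k → *-congˡ (x≋ k)))) ⟩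
      1# * b - ⟨ a , combination t w ⟩        ≈⟨ +-congʳ (*-congʳ Σt≈1) ⟨
      sum t * b - ⟨ a , combination t w ⟩     ≈⟨ sum-slack a b t w ⟨
      sum (λ i → t i * slack a b (w i))      ∎

    slack-nonneg : ∀ {a b x} → ⟨ a , x ⟩ ≤ b → 0# ≤ slack a b x
    slack-nonneg ax≤b slack<0 = ax≤b (y-x<0⇒y<x slack<0)

    slack-zero : ∀ {a b x} → slack a b x ≈ 0# → ⟨ a , x ⟩ ≈ b
    slack-zero slack≈0 = sym (x∙y⁻¹≈ε⇒x≈y _ _ slack≈0)

    zero-slack : ∀ {a b x} → ⟨ a , x ⟩ ≈ b → slack a b x ≈ 0#
    zero-slack ax≈b = x≈y⇒x∙y⁻¹≈ε (sym ax≈b)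

    -- Restrictions of affine functionals on ℝᴺ to the points of v.
    Affine : ∀ {n} → Vector (Point N) n → Vector Carrier n → Set _
    Affine v g = ∀ t → sum t ≈ 0# → (∀ k → combination t v k ≈ 0#) → sum (λ i → t i * g i) ≈ 0#

    slack-affine : ∀ {n} (v : Vector (Point N) n) a b → Affine v (λ i → slack a b (v i))
    slack-affine v a b t Σt≈0 comb≈0 = begin
      sum (λ i → t i * slack a b (v i))      ≈⟨ sum-slack a b t v ⟩
      sum t * b - ⟨ a , combination t v ⟩
        ≈⟨ +-cong (trans (*-congʳ Σt≈0) (zeroˡ b))
                  (trans (-‿cong (sum-zero {N} (λ k → trans (*-congˡ (comb≈0 k)) (zeroʳ (a k))))) -0#≈0#) ⟩
      0# + 0#                                ≈⟨ +-identityˡ 0# ⟩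
      0#                                     ∎

    Affine-scale : ∀ {n} {v : Vector (Point N) n} {g} r → Affine v g → Affine v (λ i → r * g i)
    Affine-scale {n} {g = g} r aff t Σt≈0 comb≈0 = begin
      sum (λ i → t i * (r * g i))
        ≈⟨ sum-cong-≋ {n} (λ i → solve 3 (λ t r g → t :* (r :* g) := r :* (t :* g)) refl (t i) r (g i)) ⟩
      sum (λ i → r * (t i * g i))    ≈⟨ *-distribˡ-sum {n} r _ ⟨
      r * sum (λ i → t i * g i)      ≈⟨ *-congˡ (aff t Σt≈0 comb≈0) ⟩
      r * 0#                         ≈⟨ zeroʳ r ⟩
      0#                             ∎

    -- An affine relation among points that are themselves affine combinations of `v` becomes, after
    -- exchanging the sums, an affine relation on `v`, to which `g` can be applied.
    Affine-evaluate : ∀ {m n} {v : Vector (Point N) n} {g} → Affine v g →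
      (M : Fin m → Vector Carrier n) → (∀ i → sum (M i) ≈ 1#) →
      ∀ t → sum t ≈ 0# → (∀ k → combination t (λ i → combination (M i) v) k ≈ 0#) →
      sum (λ i → t i * sum (λ j → M i j * g j)) ≈ 0#
    Affine-evaluate {m} {v = v} {g} aff M rows t Σt≈0 comb≈0 = trans (sym (sum-swap t M g))
      (aff (λ j → sum (λ i → t i * M i j))
        (trans (sum-swap-ones t M) (trans (sum-cong-≋ {m} (λ i → trans (*-congˡ (rows i)) (*-identityʳ (t i)))) Σt≈0))
        (λ k → trans (sum-swap t M (λ j → v j k)) (comb≈0 k)))

    tailIndependent : ∀ {m} {w : Vector (Point N) (suc m)} → AffinelyIndependent w → AffinelyIndependent (w ∘ suc)
    tailIndependent ind t Σt≈0 comb≈0 i = ind (0# ◂ t)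
      (trans (+-identityˡ _) Σt≈0)
      (λ k → trans (+-cong (zeroˡ _) (comb≈0 k)) (+-identityˡ 0#)) (suc i)

    ContainsIndependent-≤ : ∀ {ℓ j k} {S : Pred (Point N) ℓ} → j ℕ.≤ k → ContainsIndependent S k → ContainsIndependent S j
    ContainsIndependent-≤ {S = S} j≤k = go (ℕ.≤⇒≤′ j≤k)
      where
      go : ∀ {j k} → j ℕ.≤′ k → ContainsIndependent S k → ContainsIndependent S j
      go ℕ.≤′-refl        ind            = ind
      go (ℕ.≤′-step j≤′k) (w , w∈ , ind) = go j≤′k (w ∘ suc , (λ i → w∈ (suc i)) , tailIndependent {w = w} ind)

    dimension-unique : ∀ {ℓ j k} {S : Pred (Point N) ℓ} → HasDimension S j → HasDimension S k → j ≡ k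
    dimension-unique {j = j} {k} {S} (has-j , ¬j) (has-k , ¬k) with ℕ.<-cmp j k
    ... | tri< j<k _ _ = contradiction (ContainsIndependent-≤ {S = S} (ℕ.s≤s j<k) has-k) ¬j
    ... | tri≈ _ j≡k _ = j≡k
    ... | tri> _ _ k<j = contradiction (ContainsIndependent-≤ {S = S} (ℕ.s≤s k<j) has-j) ¬k

    -- Coefficients are pushed forward along `ι`; by injectivity the one at `ι i₀` is exactly
    -- `t i₀`.
    reindexedIndependent : ∀ {l m} {w : Vector (Point N) m} {y : Vector (Point N) l} (ι : Fin l → Fin m) →
      (∀ {i j} → ι i ≡ ι j → i ≡ j) → (∀ i → y i ≋ w (ι i)) → AffinelyIndependent w → AffinelyIndependent y
    reindexedIndependent {l} {m} {w} {y} ι ι-inj y≋ ind t Σt≈0 comb≈0 i₀ = begin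
      t i₀                              ≈⟨ sum-δ i₀ t ⟨
      sum (λ i → δ i₀ i * t i)          ≈⟨ sum-cong-≋ {l} (λ i → trans (*-comm _ _) (*-congˡ (reflexive (δ-ι i)))) ⟩
      sum (λ i → t i * δ (ι i) (ι i₀))  ≈⟨ ind (λ k → sum (λ i → t i * δ (ι i) k)) Σ≈0 c≈0 (ι i₀) ⟩
      0#                                ∎
      where
      δ-ι : ∀ i → δ i₀ i ≡ δ (ι i) (ι i₀)
      δ-ι i with i₀ Fin.≟ i
      ... | yes ≡.refl = ≡.trans (δ-refl i₀) (≡.sym (δ-refl (ι i₀)))
      ... | no i₀≢i = ≡.trans (δ-≢ i₀≢i) (≡.sym (δ-≢ (i₀≢i ∘ ≡.sym ∘ ι-inj)))
      Σ≈0 : sum (λ k → sum (λ i → t i * δ (ι i) k)) ≈ 0#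
      Σ≈0 = trans (sum-swap-ones t (δ ∘ ι))
        (trans (sum-cong-≋ {l} (λ i → trans (*-congˡ (sum-δ-1 (ι i))) (*-identityʳ (t i)))) Σt≈0)
      c≈0 : ∀ k → combination (λ k → sum (λ i → t i * δ (ι i) k)) w k ≈ 0#
      c≈0 k = trans (sum-swap t (δ ∘ ι) (λ j → w j k))
        (trans (sum-cong-≋ {l} (λ i → *-congˡ (trans (sum-δ (ι i) (λ j → w j k)) (sym (y≋ i k))))) (comb≈0 k))

  -- The barycentre enters only through `constant`: on functionals with vertex values adding up to 1
  -- it always takes the value `1 / n`.
  record Expansion {N n} (v : Vector (Point N) n) (e : Subset n) (p : Fin n) : Set (c ⊔ ℓ₁) where
    field
      constant    : Carrier
      coefficient : Vector Carrier n
      supported   : ∀ j → j ∉ e → coefficient j ≈ 0#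
      expand      : ∀ {g} → Affine v g → sum g ≈ 1# → g p ≈ constant + sum (λ j → coefficient j * g j)

  -- height is the affine functional that cuts out the facet, scaled so that its values
  -- at the vertices add up to 1; dual j p is the coefficient of vertex j in an affine
  -- expansion of vertex p over the facet and the barycentre of all vertices; negative
  -- records the lexicographic signs of the vectors dual j.
  record FacetData {N n} (v : Vector (Point N) n) (d : ℕ) (e : Subset n) : Set (c ⊔ ℓ₁ ⊔ ℓ₃) where
    field
      size          : ∣ e ∣ ≡ suc d
      height        : Vector Carrier n
      height-zero   : ∀ i → i ∈ e → height i ≈ 0#
      height-pos    : ∀ i → i ∉ e → 0# < height i
      height-affine : Affine v height
      height-sum    : sum height ≈ 1#
      dual          : Fin n → Vector Carrier n
      dual-zero     : ∀ j → j ∉ e → ∀ p → dual j p ≈ 0#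
      expand        : ∀ {g} → Affine v g → sum g ≈ 1# → ∀ p → g p ≈ height p + sum (λ j → dual j p * g j)
      negative      : Subset n
      dual-negative : ∀ j → j ∈ negative → Negative.Cone (dual j)
      dual-positive : ∀ j → j ∉ negative → Positive.Cone (dual j)

  -- A single facet: its size, its height and its dual vectors.

  module _ {N n} {P : Polytope N n} {d : ℕ} (dimP : HasDimension (body P) (suc d))
           {F : Pred (Point N) (c ⊔ ℓ₁ ⊔ ℓ₃)} (facetF : Facet P F) (simplexF : IsSimplex F)
           {e : Subset n} (e⇔F : ∀ i → i ∈ e ⇔ F (Polytope.vertex P i)) where
    open Polytope P using (vertex; vertex-injective; vertex-isFace)

    private
      a = proj₁ (proj₁ facetF)
      b = proj₁ (proj₂ (proj₁ facetF))
      bound = proj₁ (proj₂ (proj₂ (proj₁ facetF)))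
      F⊆ = proj₁ (proj₂ (proj₂ (proj₂ (proj₁ facetF))))
      F⊇ = proj₂ (proj₂ (proj₂ (proj₂ (proj₁ facetF))))

      dimF : HasDimension F d
      dimF with proj₂ facetF
      ... | k , dimP′ , dimF′ with ≡.refl ← dimension-unique {S = body P} dimP dimP′ = dimF′

      u : Vector (Point N) (suc d)
      u = proj₁ (proj₁ dimF)
      u∈F : ∀ i → F (u i)
      u∈F = proj₁ (proj₂ (proj₁ dimF))
      u-independent : AffinelyIndependent u
      u-independent = proj₂ (proj₂ (proj₁ dimF))

      T : Fin (suc d) → Vector Carrier n
      T i = proj₁ (proj₁ (F⊆ (u∈F i)))
      T-nonneg : ∀ i j → 0# ≤ T i j
      T-nonneg i = proj₁ (proj₂ (proj₁ (F⊆ (u∈F i))))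
      T-sum : ∀ i → sum (T i) ≈ 1#
      T-sum i = proj₁ (proj₂ (proj₂ (proj₁ (F⊆ (u∈F i)))))
      T-point : ∀ i → u i ≋ combination (T i) vertex
      T-point i = proj₂ (proj₂ (proj₂ (proj₁ (F⊆ (u∈F i)))))

      raw : Vector Carrier n
      raw i = slack a b (vertex i)

      raw-nonneg : ∀ i → 0# ≤ raw i
      raw-nonneg i = slack-nonneg {a = a} {b} {vertex i} (bound (vertex i) (generator∈conv vertex i))

      raw-zero : ∀ i → i ∈ e → raw i ≈ 0#
      raw-zero i i∈e = zero-slack {a = a} {b} {vertex i} (proj₂ (F⊆ (Equivalence.to (e⇔F i) i∈e)))

      raw-nonzero : ∀ i → i ∉ e → ¬ (raw i ≈ 0#)
      raw-nonzero i i∉e raw≈0 = i∉e (Equivalence.from (e⇔F i)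
        (F⊇ (generator∈conv vertex i , slack-zero {a = a} {b} {vertex i} raw≈0)))

      -- Otherwise every slack is zero, the whole polytope lies in `F`, and `F` contains more
      -- independent points than its dimension allows.
      raw-sum-nonzero : ¬ (sum raw ≈ 0#)
      raw-sum-nonzero Σ≈0 = proj₂ dimF (proj₁ (proj₁ dimP) , (λ i → body⊆F (proj₁ (proj₂ (proj₁ dimP)) i)) , proj₂ (proj₂ (proj₁ dimP)))
        where
        body⊆F : ∀ {x} → body P x → F x
        body⊆F {x} x∈@(t , _ , Σt≈1 , x≋) = F⊇ (x∈ , slack-zero {a = a} {b} {x}
          (trans (slack-combination a b {w = vertex} Σt≈1 x≋)
            (sum-zero {n} (λ i → trans (*-congˡ (0≤-sum-zero raw-nonneg Σ≈0 i)) (zeroʳ (t i))))))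

      -- The slack at `u i` is zero and is the sum of these nonnegative terms.
      T*raw : ∀ i j → T i j * raw j ≈ 0#
      T*raw i = 0≤-sum-zero (λ j → 0≤-* (T-nonneg i j) (raw-nonneg j))
        (trans (sym (slack-combination a b {w = vertex} (T-sum i) (T-point i)))
               (zero-slack {a = a} {b} {u i} (proj₂ (F⊆ (u∈F i)))))

      T-supported : ∀ i j → j ∉ e → T i j ≈ 0#
      T-supported i j j∉e = *-cancelˡ-0 (raw-nonzero j j∉e) (trans (*-comm (raw j) (T i j)) (T*raw i j))

    -- The `suc d` weight vectors `T i` are supported on `e`. If `e` were smaller, a linear relation
    -- among them would be an affine relation among the independent points `u i`.
    size-lower : suc d ℕ.≤ ∣ e ∣
    size-lower = ℕ.≮⇒≥ λ ∣e∣< → nontrivialRelation e T T-supported ∣e∣< λ { (x , x≉0 , rel) →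
      x≉0 (u-independent x
        (begin
          sum x                                   ≈⟨ sum-cong-≋ {suc d} (λ i → trans (*-congˡ (T-sum i)) (*-identityʳ (x i))) ⟨
          sum (λ i → x i * sum (T i))             ≈⟨ sum-swap-ones x T ⟨
          sum (λ j → sum (λ i → x i * T i j))     ≈⟨ sum-zero {n} rel ⟩
          0#                                      ∎)
        (λ k → begin
          sum (λ i → x i * u i k)                            ≈⟨ sum-cong-≋ {suc d} (λ i → *-congˡ {x i} (T-point i k)) ⟩
          sum (λ i → x i * combination (T i) vertex k)       ≈⟨ sum-swap x T (λ j → vertex j k) ⟨
          sum (λ j → sum (λ i → x i * T i j) * vertex j k)   ≈⟨ sum-zero {n} (λ j → trans (*-congʳ (rel j)) (zeroˡ _)) ⟩
          0#                                                 ∎)) }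

    -- A vertex of P lying in conv w ⊆ P is an extreme point, hence one of the w k.
    vertex-among : ∀ {m} {w : Vector (Point N) m} → (∀ k → body P (w k)) → ∀ i → conv w (vertex i) →
                   ¬ ¬ (∃[ k ] vertex i ≋ w k)
    vertex-among {m} {w} w∈ i (t , 0≤t , Σt≈1 , v≋) with vertex-isFace i
    ... | a′ , b′ , bound′ , ⊆face , ⊇face = do
      k , tk≉0 ← ¬∀⇒¬¬∃ (λ t≈0 → 1≉0 (trans (sym Σt≈1) (sum-zero {m} t≈0)))
      return (k , ≋-sym (⊇face (w∈ k , slack-zero {a = a′} {b′} {w k} (*-cancelˡ-0 tk≉0 (terms k)))))
      where
      terms : ∀ k → t k * slack a′ b′ (w k) ≈ 0#
      terms = 0≤-sum-zero (λ k → 0≤-* (0≤t k) (slack-nonneg {a = a′} {b′} {w k} (bound′ (w k) (w∈ k))))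
        (trans (sym (slack-combination a′ b′ {w = w} Σt≈1 v≋))
               (zero-slack {a = a′} {b′} {vertex i} (proj₂ (⊆face ≋-refl))))

    -- The vertices in `e` are among the corners of the simplex `F` and hence independent; `d + 2`
    -- of them would exceed the dimension of `F`.
    size-upper : ∣ e ∣ ℕ.≤ suc d
    size-upper = ℕ.≮⇒≥ λ d< → large d< id
      where
      large : suc d ℕ.< ∣ e ∣ → ¬ ¬ _
      large d< = do
        let ι , ι∈ , ι-inj = enumerate e d<
            m , w , w-ind , F⊆w , w⊆F = simplexF
        f ← ¬¬-Fin (λ i → vertex-among (λ k → proj₁ (F⊆ (w⊆F (generator∈conv w k)))) (ι i) (F⊆w (Equivalence.to (e⇔F (ι i)) (ι∈ i))))
        contradiction
          ( vertex ∘ ι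
          , (λ i → Equivalence.to (e⇔F (ι i)) (ι∈ i))
          , reindexedIndependent {w = w} {y = vertex ∘ ι} (proj₁ ∘ f)
              (λ {i} {j} eq → ι-inj (vertex-injective (≋-trans (proj₂ (f i))
                (≡.subst (λ k → w k ≋ vertex (ι j)) (≡.sym eq) (≋-sym (proj₂ (f j)))))))
              (proj₂ ∘ f) w-ind
          )
          (proj₂ dimF)

    -- The `d + 3` points given by `p`, the barycentre and the `u i` are affinely dependent by
    -- dimension. In a nontrivial relation the coefficient of `p` cannot vanish, so the relation is
    -- solved for `p`.
    expansion : ∀ p → ¬ ¬ Expansion vertex e p
    expansion p = do
      t , Σt≈0 , comb≈0 , t≉0 ← dependent
      t₀#0 ← ≉⇒¬¬# (λ t₀≈0 → t≉0 (rest-zero t Σt≈0 comb≈0 t₀≈0))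
      return (solved t Σt≈0 comb≈0 (proj₁ (inverse t₀#0)) (proj₂ (inverse t₀#0)))
      where
      -- The weight `1 / n` of the barycentre; the vertex `p` shows that `n` is positive.
      weight = posInverse (sum-ones-pos p)
      q = proj₁ weight
      Σq : ∀ {g : Vector Carrier n} → sum (λ j → q * g j) ≈ q * sum g
      Σq {g} = sym (*-distribˡ-sum {n} q g)

      M : Fin (suc (suc (suc d))) → Vector Carrier n
      M = δ p ◂ ((λ _ → q) ◂ T)

      M-sum : ∀ i → sum (M i) ≈ 1#
      M-sum zero          = sum-δ-1 p
      M-sum (suc zero)    = begin
        sum {n} (λ _ → q)        ≈⟨ sum-cong-≋ {n} (λ _ → *-identityʳ q) ⟨
        sum {n} (λ _ → q * 1#)   ≈⟨ Σq ⟩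
        q * sum {n} (λ _ → 1#)   ≈⟨ *-comm q _ ⟩
        sum {n} (λ _ → 1#) * q   ≈⟨ proj₂ (proj₂ weight) ⟩
        1#                       ∎
      M-sum (suc (suc i)) = T-sum i

      M-nonneg : ∀ i j → 0# ≤ M i j
      M-nonneg zero          = δ-nonneg p
      M-nonneg (suc zero)    = λ _ → pos⇒0≤ (proj₁ (proj₂ weight))
      M-nonneg (suc (suc i)) = T-nonneg i

      points : Vector (Point N) (suc (suc (suc d)))
      points i = combination (M i) vertex

      dependent : ¬ ¬ (Σ (Vector Carrier (suc (suc (suc d)))) λ t →
        sum t ≈ 0# × (∀ k → combination t points k ≈ 0#) × ¬ (∀ i → t i ≈ 0#))
      dependent ¬dep = proj₂ dimP
        ( points
        , (λ i → M i , M-nonneg i , M-sum i , ≋-refl)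
        , λ t Σt≈0 comb≈0 i → ≈-stable (λ ti≉0 → ¬dep (t , Σt≈0 , comb≈0 , λ t≈0 → ti≉0 (t≈0 i)))
        )

      drop-zeros : ∀ {x y z} → x ≈ 0# → y ≈ 0# → x + (y + z) ≈ 0# → z ≈ 0#
      drop-zeros x≈0 y≈0 Σ≈0 = trans (sym (trans (+-cong x≈0 (trans (+-congʳ y≈0) (+-identityˡ _))) (+-identityˡ _))) Σ≈0

      -- The slack functional vanishes on the points `u i` but not at the barycentre, so the
      -- coefficient of the barycentre is zero; independence of the `u i` removes the rest.
      rest-zero : ∀ t → sum t ≈ 0# → (∀ k → combination t points k ≈ 0#) → t zero ≈ 0# → ∀ i → t i ≈ 0#
      rest-zero t Σt≈0 comb≈0 t₀≈0 = λ
        { zero          → t₀≈0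
        ; (suc zero)    → t₁≈0
        ; (suc (suc i)) → u-independent (λ i → t (suc (suc i)))
            (drop-zeros t₀≈0 t₁≈0 Σt≈0)
            (λ k → trans (sum-cong-≋ {suc d} (λ i → *-congˡ {t (suc (suc i))} (T-point i k)))
                     (drop-zeros (trans (*-congʳ t₀≈0) (zeroˡ _)) (trans (*-congʳ t₁≈0) (zeroˡ _)) (comb≈0 k)))
            i
        }
        where
        facet-part : sum (λ i → t (suc (suc i)) * sum (λ j → T i j * raw j)) ≈ 0#
        facet-part = sum-zero {suc d} (λ i → trans (*-congˡ {t (suc (suc i))} (sum-zero {n} (T*raw i))) (zeroʳ _))
        t₁*≈0 : t (suc zero) * sum (λ j → q * raw j) ≈ 0#
        t₁*≈0 = drop-zeros (trans (*-congʳ t₀≈0) (zeroˡ _)) facet-part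
          (trans (+-congˡ (+-comm _ _)) (Affine-evaluate (slack-affine vertex a b) M M-sum t Σt≈0 comb≈0))
        t₁≈0 : t (suc zero) ≈ 0#
        t₁≈0 = *-cancelˡ-0 (λ q*Σ≈0 → raw-sum-nonzero (*-cancelˡ-0 (pos⇒≉0 (proj₁ (proj₂ weight))) (trans (sym Σq) q*Σ≈0)))
          (trans (*-comm _ _) t₁*≈0)

      solved : ∀ t → sum t ≈ 0# → (∀ k → combination t points k ≈ 0#) →
               ∀ y → t zero * y ≈ 1# → Expansion vertex e p
      solved t Σt≈0 comb≈0 y t₀y≈1 = record
        { constant    = - y * (t₁ * q)
        ; coefficient = λ j → - y * σ j
        ; supported   = λ j j∉e → trans (*-congˡ (sum-zero {suc d} (λ i → trans (*-congˡ {t (suc (suc i))} (T-supported i j j∉e)) (zeroʳ _)))) (zeroʳ (- y))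
        ; expand      = expand
        }
        where
        t₀ = t zero
        t₁ = t (suc zero)
        -- The total weight that the facet points in the relation put on vertex `j`.
        σ : Vector Carrier n
        σ j = sum (λ i → t (suc (suc i)) * T i j)
        expand : ∀ {g} → Affine vertex g → sum g ≈ 1# → g p ≈ - y * (t₁ * q) + sum (λ j → - y * σ j * g j)
        expand {g} aff Σg≈1 = sym (begin
          - y * (t₁ * q) + sum (λ j → - y * σ j * g j)
            ≈⟨ +-congˡ (trans (sum-cong-≋ {n} (λ j → *-assoc (- y) (σ j) (g j))) (sym (*-distribˡ-sum {n} (- y) _))) ⟩
          - y * (t₁ * q) + - y * sum (λ j → σ j * g j)
            ≈⟨ distribˡ (- y) _ _ ⟨
          - y * (t₁ * q + sum (λ j → σ j * g j))
            ≈⟨ *-congˡ (+-inverseʳ-unique _ _ relation) ⟩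
          - y * - (t₀ * g p)
            ≈⟨ trans (sym (-‿distribʳ-* (- y) _)) (trans (-‿cong (sym (-‿distribˡ-* y _))) (-‿involutive _)) ⟩
          y * (t₀ * g p)
            ≈⟨ solve 3 (λ y t g → y :* (t :* g) := t :* y :* g) refl y t₀ (g p) ⟩
          t₀ * y * g p
            ≈⟨ trans (*-congʳ t₀y≈1) (*-identityˡ (g p)) ⟩
          g p ∎)
          where
          relation : t₀ * g p + (t₁ * q + sum (λ j → σ j * g j)) ≈ 0#
          relation = begin
            t₀ * g p + (t₁ * q + sum (λ j → σ j * g j))
              ≈⟨ +-cong (*-congˡ (sum-δ p g))
                   (+-cong (*-congˡ (trans Σq (trans (*-congˡ Σg≈1) (*-identityʳ q)))) (sym (sum-swap (λ i → t (suc (suc i))) T g))) ⟨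
            sum (λ i → t i * sum (λ j → M i j * g j))
              ≈⟨ Affine-evaluate aff M M-sum t Σt≈0 comb≈0 ⟩
            0# ∎

    facetData : ¬ ¬ FacetData vertex d e
    facetData = do
      Σ-pos ← ≤⇒¬¬< (0≤-sum raw-nonneg) (λ 0≈Σ → raw-sum-nonzero (sym 0≈Σ))
      expansions ← ¬¬-Fin expansion
      pos ← ¬¬-Fin (λ i → positive i (proj₁ (posInverse Σ-pos)) (proj₁ (proj₂ (posInverse Σ-pos))))
      signs ← ¬¬-Fin (λ j → lexTotal (λ p → Expansion.coefficient (expansions p) j))
      return (assemble Σ-pos expansions pos signs)
      where
      positive : ∀ i r → 0# < r → ¬ ¬ (i ∉ e → 0# < r * raw i)
      positive i r 0<r with i Subset.∈? e
      ... | yes i∈e = return (λ i∉e → contradiction i∈e i∉e)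
      ... | no  i∉e = do
        0<raw ← ≤⇒¬¬< (raw-nonneg i) (raw-nonzero i i∉e ∘ sym)
        return (λ _ → *-pos 0<r 0<raw)

      assemble : (Σ-pos : 0# < sum raw) → let r = proj₁ (posInverse Σ-pos) in
        (expansions : ∀ p → Expansion vertex e p) → (∀ i → i ∉ e → 0# < r * raw i) →
        (∀ j → let s = λ p → Expansion.coefficient (expansions p) j in Positive.Cone s ⊎ Negative.Cone s) →
        FacetData vertex d e
      assemble Σ-pos expansions pos signs = record
        { size          = ℕ.≤-antisym size-upper size-lower
        ; height        = h
        ; height-zero   = h-zero
        ; height-pos    = pos
        ; height-affine = h-affine
        ; height-sum    = h-sum
        ; dual          = λ j p → coefficient p j
        ; dual-zero     = λ j j∉e p → Expansion.supported (expansions p) j j∉e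
        ; expand        = λ aff Σ≈1 p → trans (Expansion.expand (expansions p) aff Σ≈1) (+-congʳ (constant≈h p))
        -- A zero vector lies in both cones; the subset remembers the alternative that `signs`
        -- supplies.
        ; negative      = tabulate (isNegative ∘ signs)
        ; dual-negative = λ j j∈ → negative⁻ j (≡.trans (≡.sym (lookup∘tabulate (isNegative ∘ signs) j)) ([]=⇒lookup j∈))
        ; dual-positive = λ j j∉ → positive⁻ j λ eq → j∉ (lookup⇒[]= j _ (≡.trans (lookup∘tabulate (isNegative ∘ signs) j) eq))
        }
        where
        r = proj₁ (posInverse Σ-pos)
        h : Vector Carrier n
        h i = r * raw i
        h-zero : ∀ i → i ∈ e → h i ≈ 0#
        h-zero i i∈e = trans (*-congˡ (raw-zero i i∈e)) (zeroʳ r)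
        h-affine : Affine vertex h
        h-affine = Affine-scale r (slack-affine vertex a b)
        h-sum : sum h ≈ 1#
        h-sum = trans (sym (*-distribˡ-sum {n} r raw)) (trans (*-comm r _) (proj₂ (proj₂ (posInverse Σ-pos))))
        coefficient : ∀ p → Vector Carrier n
        coefficient p = Expansion.coefficient (expansions p)
        coefficient*h : ∀ p j → coefficient p j * h j ≈ 0#
        coefficient*h p j with j Subset.∈? e
        ... | yes j∈e = trans (*-congˡ (h-zero j j∈e)) (zeroʳ _)
        ... | no  j∉e = trans (*-congʳ (Expansion.supported (expansions p) j j∉e)) (zeroˡ _)
        -- The expansion is applied to the height itself, which vanishes on `e`, where the
        -- coefficients are supported.
        constant≈h : ∀ p → Expansion.constant (expansions p) ≈ h p
        constant≈h p = sym (trans (Expansion.expand (expansions p) h-affine h-sum)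
          (trans (+-congˡ (sum-zero {n} (coefficient*h p))) (+-identityʳ _)))
        isNegative : ∀ {A B : Set _} → A ⊎ B → Side
        isNegative (inj₁ _) = outside
        isNegative (inj₂ _) = inside
        negative⁻ : ∀ j → isNegative (signs j) ≡ inside → Negative.Cone (λ p → coefficient p j)
        negative⁻ j eq with signs j
        ... | inj₂ neg = neg
        positive⁻ : ∀ j → isNegative (signs j) ≢ inside → Positive.Cone (λ p → coefficient p j)
        positive⁻ j neq with signs j
        ... | inj₁ pos = pos
        ... | inj₂ _   = contradiction ≡.refl neq

  -- Either signed part determines the facet.

  module _ {N n d : ℕ} {v : Vector (Point N) n} where
    open FacetData

    negativePart positivePart : ∀ {e} → FacetData v d e → Subset n
    negativePart {e} f = e ∩ negative f
    positivePart {e} f = e ∩ ∁ (negative f)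

    sameHeight⇒⊆ : ∀ {e e′} (f : FacetData v d e) (f′ : FacetData v d e′) →
                   (∀ p → height f p ≈ height f′ p) → ∀ {i} → i ∈ e → i ∈ e′
    sameHeight⇒⊆ {e} {e′} f f′ h≈h′ {i} i∈e = decidable-stable (i Subset.∈? e′) λ i∉e′ →
      pos⇒≉0 (height-pos f′ i i∉e′) (trans (sym (h≈h′ i)) (height-zero f i i∈e))

    -- Expanding each height over the other facet gives `h′ = h + x` and `h = h′ + x′`, so
    -- `x + x′ = 0`. Once `x` vanishes the heights agree, and with them their zero sets `e` and
    -- `e′`.
    determined : ∀ {e e′} (f : FacetData v d e) (f′ : FacetData v d e′) →
      let x  = λ p → sum (λ j → dual f  j p * height f′ j)
          x′ = λ p → sum (λ j → dual f′ j p * height f  j)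
      in ((∀ p → x p + x′ p ≈ 0#) → ∀ p → x p ≈ 0#) → e ≡ e′
    determined f f′ pointed = Subset.⊆-antisym (sameHeight⇒⊆ f f′ (sym ∘ h′≈h)) (sameHeight⇒⊆ f′ f h′≈h)
      where
      x x′ : Vector Carrier n
      x  p = sum (λ j → dual f  j p * height f′ j)
      x′ p = sum (λ j → dual f′ j p * height f  j)
      h′≈h+x : ∀ p → height f′ p ≈ height f p + x p
      h′≈h+x = expand f (height-affine f′) (height-sum f′)
      h≈h′+x′ : ∀ p → height f p ≈ height f′ p + x′ p
      h≈h′+x′ = expand f′ (height-affine f) (height-sum f)
      x+x′≈0 : ∀ p → x p + x′ p ≈ 0#
      x+x′≈0 p = +-identityʳ-unique (height f p) (x p + x′ p) (begin
        height f p + (x p + x′ p)   ≈⟨ +-assoc (height f p) (x p) (x′ p) ⟨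
        height f p + x p + x′ p     ≈⟨ +-congʳ (h′≈h+x p) ⟨
        height f′ p + x′ p          ≈⟨ h≈h′+x′ p ⟨
        height f p                  ∎)
      h′≈h : ∀ p → height f′ p ≈ height f p
      h′≈h p = trans (h′≈h+x p) (trans (+-congˡ (pointed x+x′≈0 p)) (+-identityʳ (height f p)))

    -- Only `j` in `e` outside `e′` contribute to `x`. Such a `j` is not negative for `f`, since the
    -- common negative part lies in `e′`; so `x` is a sum of positive multiples of lexicographically
    -- nonnegative vectors, and likewise `x′`.
    negativePart-injective : ∀ {e e′} (f : FacetData v d e) (f′ : FacetData v d e′) →
                             negativePart f ≡ negativePart f′ → e ≡ e′
    negativePart-injective f f′ same =
      determined f f′ (Positive.Cone-pointed (cone f f′ same) (cone f′ f (≡.sym same)))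
      where
      cone : ∀ {e e′} (f : FacetData v d e) (f′ : FacetData v d e′) → negativePart f ≡ negativePart f′ →
             Positive.Cone (λ p → sum (λ j → dual f j p * height f′ j))
      cone {e} {e′} f f′ same = Positive.Cone-weightedSum (dual f) (height f′) term
        where
        term : ∀ j → (∀ p → dual f j p ≈ 0#) ⊎ height f′ j ≈ 0# ⊎ (Positive.Cone (dual f j) × 0# < height f′ j)
        term j with j Subset.∈? e | j Subset.∈? e′ | j Subset.∈? negative f
        ... | no j∉e  | _        | _       = inj₁ (dual-zero f j j∉e)
        ... | yes _   | yes j∈e′ | _       = inj₂ (inj₁ (height-zero f′ j j∈e′))
        ... | yes _   | no  j∉e′ | no j∉   = inj₂ (inj₂ (dual-positive f j j∉ , height-pos f′ j j∉e′))
        ... | yes j∈e | no  j∉e′ | yes j∈  = contradiction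
          (proj₁ (Subset.x∈p∩q⁻ e′ _ (≡.subst (j ∈_) same (Subset.x∈p∩q⁺ (j∈e , j∈))))) j∉e′

    -- The same argument with both signs exchanged.
    positivePart-injective : ∀ {e e′} (f : FacetData v d e) (f′ : FacetData v d e′) →
                             positivePart f ≡ positivePart f′ → e ≡ e′
    positivePart-injective f f′ same =
      determined f f′ (Negative.Cone-pointed (cone f f′ same) (cone f′ f (≡.sym same)))
      where
      cone : ∀ {e e′} (f : FacetData v d e) (f′ : FacetData v d e′) → positivePart f ≡ positivePart f′ →
             Negative.Cone (λ p → sum (λ j → dual f j p * height f′ j))
      cone {e} {e′} f f′ same = Negative.Cone-weightedSum (dual f) (height f′) term
        where
        term : ∀ j → (∀ p → dual f j p ≈ 0#) ⊎ height f′ j ≈ 0# ⊎ (Negative.Cone (dual f j) × 0# < height f′ j)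
        term j with j Subset.∈? e | j Subset.∈? e′ | j Subset.∈? negative f
        ... | no j∉e  | _        | _       = inj₁ (dual-zero f j j∉e)
        ... | yes _   | yes j∈e′ | _       = inj₂ (inj₁ (height-zero f′ j j∈e′))
        ... | yes _   | no  j∉e′ | yes j∈  = inj₂ (inj₂ (dual-negative f j j∈ , height-pos f′ j j∉e′))
        ... | yes j∈e | no  j∉e′ | no j∉   = contradiction
          (proj₁ (Subset.x∈p∩q⁻ e′ _ (≡.subst (j ∈_) same (Subset.x∈p∩q⁺ (j∈e , Subset.x∉p⇒x∈∁p j∉))))) j∉e′

-- The bound for simplicial polytopes.

open import Data.Nat.Base using (ℕ; suc; _≤_; _*_; _^_; _∸_; ⌈_/2⌉; ⌊_/2⌋)
open import Data.Product.Base using (∃-syntax)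

theorem1p4 : ∀ {c ℓ₁ ℓ₂ ℓ₃} (ℝ : Reals c ℓ₁ ℓ₂ ℓ₃) → let open Polytopes ℝ in
    (d : ℕ) → 1 ≤ d →
    ∃[ C ] (∀ {N n} (P : Polytope N n) →
    HasDimension (body P) (suc d) → Simplicial P →
    ∀ χ → IsChromaticNumber (facetHypergraph P) χ →
    χ ^ d ≤ (C ^ d) * (n ^ (⌈ d /2⌉ ∸ 1)))
theorem1p4 ℝ (suc d) 1≤d = chromaticConstant (suc d) r , bound
  where
  open Polytopes ℝ
  open FacetGeometry ℝ
  open FacetData
  open Combinatorics
  -- The dimension parameter is now `suc d`, and `⌈ suc d /2⌉ ∸ 1` computes to `⌊ d /2⌋`.
  r = ⌊ d /2⌋

  bound : ∀ {N n} (P : Polytope N n) → HasDimension (body P) (2 ℕ.+ d) → Simplicial P →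
          ∀ χ → IsChromaticNumber (facetHypergraph P) χ →
          χ ^ suc d ≤ chromaticConstant (suc d) r ^ suc d * n ^ r
  bound {N} {n} P dimP simplicial χ (_ , least) = decidable-stable (_ ℕ.≤? _) do
    -- Whether some facet has a given part is not decidable; the finitely many decisions are assumed
    -- at once, as the goal is stable.
    dec⁻ ← ¬¬-Subset (λ A → ¬¬-excluded-middle)
    dec⁺ ← ¬¬-Subset (λ A → ¬¬-excluded-middle)
    let m , m^d≤ , colour , proper = fewColours Edge 1≤d r
          (edgesInside size facets negativePart positivePart
            (λ {e} f → Subset.p∩q⊆p e (negative f)) (λ {e} f → Subset.p∩q⊆p e (∁ (negative f)))
            negativePart-injective positivePart-injective
            (λ {e} f → smallHalf d (≡.trans (∣p∩q∣+∣p∩∁q∣≡∣p∣ e (negative f)) (size f)))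
            dec⁻ dec⁺)
    return (ℕ.≤-trans (ℕ.^-monoˡ-≤ (suc d) (least m (colour , λ e → proper))) m^d≤)
    where
    open Hypergraph (facetHypergraph P) using (Edge)
    facets : ∀ {e} → Edge e → ¬ ¬ FacetData (Polytope.vertex P) (suc d) e
    facets (F , facetF , e⇔F) = facetData {P = P} dimP facetF (simplicial F facetF) e⇔F
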